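{- Let $k>1$ and let $\alpha(y_1,\dots,y_k)=c\oplus y_1\oplus\cdots\oplus y_k$, with $c\in GF(2)$, be a $k$-adic linear connective. Suppose the growth process $(\mu,\alpha)$ on $n$ variables has a limiting distribution $\pi$. If $i>\frac{2\log(n)}{\log(k)}$, then for any $n$-adic linear function $f$, $|\pi(f)-\pi_i(f)|<2^{ -n}$.
   Context: A connective is a $k$-adic Boolean function $\alpha:\{0,1\}^k\to\{0,1\}$. Let $A_0=\{x_1,\dots,x_n,\bar x_1,\dots,\bar x_n,0,1\}$ be the set of projections on $n$ variables, their negations, and the two constant functions. The initial distribution $\mu$ is the uniform distribution on a subset of $A_0$ which contains the $n$ projections, may or may not contain their $n$ negations, and contains neither, one, or both constants. The growth process $(\mu,\alpha)$ gives distributions $\pi_i$ on $n$-adic Boolean functions: $\pi_0=\mu$, and for $i\ge1$, $\pi_i(f)$ is the probability that $\alpha(g_1,\dots,g_k)=f$ where $g_1,\dots,g_k$ are independent random functions distributed according to $\pi_{i-1}$. The limiting distribution is $\pi=\lim_{i\to\infty}\pi_i$ (pointwise) when it exists. A function is linear if it has the form $c_0\oplus c_1x_1\oplus\cdots\oplus c_nx_n$ with $c_j\in GF(2)$; linear connectives are assumed to depend on all their arguments. Logarithms are to base 2. -}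

module Defs where

open import Data.Bool using (Bool; true; false; not; _∧_; _xor_; if_then_else_)
import Data.Bool.Properties as Bool
open import Data.Integer as ℤ using (+_; +[1+_])
import Data.Integer.Properties as ℤ
import Data.Integer.Solver as ℤSolver
open import Data.List as List using (List; []; _∷_; _++_; length; allFin; cartesianProductWith; filter)
open import Data.List.Relation.Unary.Any using (any?)
open import Data.Nat as ℕ using (ℕ; zero; suc; z≤n; s≤s; NonZero)
import Data.Nat.Properties as ℕ
open import Data.Nat.Induction using (<-rec)
open import Data.Nat.Logarithm using (⌊log₂_⌋; ⌊log₂⌋-mono-≤; ⌊log₂⌊n/2⌋⌋≡⌊log₂n⌋∸1; ⌊log₂[2^n]⌋≡n)
open import Data.Product using (Σ; ∃-syntax; _×_; _,_; proj₁; proj₂)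
open import Data.Rational as ℚ using (ℚ; 0ℚ; 1ℚ; ½; _+_; _*_; _-_; -_; ∣_∣; _≤_; _<_; 1/_; Positive; positive; ≢-nonZero; mkℚ)
import Data.Rational.Properties as ℚ
import Data.Rational.Unnormalised as ℚᵘ
import Data.Rational.Unnormalised.Properties as ℚᵘ
open import Data.Rational.Solver using (module +-*-Solver)
open import Data.Sum using (inj₁; inj₂)
open import Data.Vec as Vec using (Vec; []; _∷_; lookup; zipWith)
open import Function using (_∘_; const)
open import Relation.Binary.PropositionalEquality using (_≡_; refl; sym; trans; cong; cong₂; subst; subst₂; _≗_)
open import Relation.Nullary using (Dec; yes; no; does; contradiction)
open import Relation.Nullary.Decidable using (map′; _×-dec_)

------------------------------------------------------------------------
-- Boolean functions

BoolFun : ℕ → Set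
BoolFun n = Vec Bool n → Bool

-- Without function extensionality, equality of Boolean functions is
-- pointwise equality _≗_.

infix 4 _≗?_

_≗?_ : ∀ {n} (f g : BoolFun n) → Dec (f ≗ g)
_≗?_ {zero}  f g = map′ (λ { p [] → p }) (λ e → e []) (f [] Bool.≟ g [])
_≗?_ {suc n} f g =
  map′ (λ { (p , q) (false ∷ x) → p x ; (p , q) (true ∷ x) → q x })
       (λ e → (e ∘ (false ∷_)) , (e ∘ (true ∷_)))
       (f ∘ (false ∷_) ≗? g ∘ (false ∷_) ×-dec f ∘ (true ∷_) ≗? g ∘ (true ∷_))

-- Every n-adic Boolean function occurs exactly once, up to _≗_.

allBoolFuns : ∀ n → List (BoolFun n)
allBoolFuns zero    = const false ∷ const true ∷ []
allBoolFuns (suc n) = cartesianProductWith branch (allBoolFuns n) (allBoolFuns n)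
  where
  branch : BoolFun n → BoolFun n → BoolFun (suc n)
  branch g h (b ∷ x) = if b then h x else g x

tuples : ∀ {A : Set} → List A → ∀ k → List (Vec A k)
tuples xs zero    = [] ∷ []
tuples xs (suc k) = cartesianProductWith _∷_ xs (tuples xs k)

compose : ∀ {k n} → BoolFun k → Vec (BoolFun n) k → BoolFun n
compose α gs x = α (Vec.map (λ g → g x) gs)

-- GF(2) is Bool, with _xor_ as addition and _∧_ as multiplication.

⨁ : ∀ {n} → Vec Bool n → Bool
⨁ = Vec.foldr′ _xor_ false

IsLinear : ∀ {n} → BoolFun n → Set
IsLinear {n} f = ∃[ c₀ ] Σ (Vec Bool n) λ c → ∀ x → f x ≡ c₀ xor ⨁ (zipWith _∧_ c x)

linearConnective : ∀ {k} → Bool → BoolFun k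
linearConnective c y = c xor ⨁ y

------------------------------------------------------------------------
-- Growth processes

-- A distribution is given by its (rational) point probabilities.

Dist : ℕ → Set
Dist n = BoolFun n → ℚ

sumℚ : List ℚ → ℚ
sumℚ = List.foldr _+_ 0ℚ

jointProb : ∀ {k n} → Dist n → Vec (BoolFun n) k → ℚ
jointProb p gs = Vec.foldr′ _*_ 1ℚ (Vec.map p gs)

-- The parameters of an admissible initial set: whether it contains the
-- negated projections, the constant 0 and the constant 1.

record InitialSet : Set where
  field
    negations? const0? const1? : Bool

projections : ∀ n → List (BoolFun n)
projections n = List.map (λ j x → lookup x j) (allFin n)

elements : InitialSet → ∀ n → List (BoolFun n)
elements S n =
  projections n
  ++ (if negations? then List.map (not ∘_) (projections n) else [])
  ++ (if const0? then const false ∷ [] else [])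
  ++ (if const1? then const true ∷ [] else [])
  where open InitialSet S

elements-nonEmpty : ∀ S n .{{_ : NonZero n}} → NonZero (length (elements S n))
elements-nonEmpty S (suc n) = _

-- For n ≥ 1 the functions in `elements S n` are pairwise distinct, so the
-- length of the list is the cardinality of the set.

μ : InitialSet → ∀ {n} .{{_ : NonZero n}} → Dist n
μ S {n} f = if does (any? (f ≗?_) (elements S n))
            then (+ 1 ℚ./ length (elements S n)) {{elements-nonEmpty S n}}
            else 0ℚ

grow : ∀ {k n} → BoolFun k → Dist n → Dist n
grow {k} {n} α p f =
  sumℚ (List.map (jointProb p) (filter (λ gs → compose α gs ≗? f) (tuples (allBoolFuns n) k)))

growth : ∀ {k n} .{{_ : NonZero n}} → InitialSet → BoolFun k → ℕ → Dist n
growth S α zero    = μ S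
growth S α (suc i) = grow α (growth S α i)

------------------------------------------------------------------------
-- Real numbers as Cauchy sequences of rationals

IsCauchy : (ℕ → ℚ) → Set
IsCauchy a = ∀ ε → 0ℚ < ε → ∃[ N ] (∀ m n → N ℕ.≤ m → N ℕ.≤ n → ∣ a m - a n ∣ < ε)

record ℝ : Set where
  constructor mkℝ
  field
    seq    : ℕ → ℚ
    cauchy : IsCauchy seq

open ℝ public

infix 4 _<ᴿ_

_<ᴿ_ : ℝ → ℝ → Set
x <ᴿ y = ∃[ ε ] (0ℚ < ε × ∃[ N ] (∀ m → N ℕ.≤ m → seq x m + ε ≤ seq y m))


-- If |Δc| ≤ K (|Δa| + |Δb|) eventually, then c is Cauchy when a and b are.
dominated : ∀ (a b c : ℕ → ℚ) → IsCauchy a → IsCauchy b →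
  ∀ K → .{{Positive K}} → ∀ N₀ →
  (∀ m n → N₀ ℕ.≤ m → N₀ ℕ.≤ n → ∣ c m - c n ∣ ≤ K * (∣ a m - a n ∣ + ∣ b m - b n ∣)) →
  IsCauchy c
dominated a b c ca cb K N₀ bound ε ε>0 = N , λ m n N≤m N≤n →
  ℚ.≤-<-trans
    (bound m n (ℕ.≤-trans (ℕ.m≤m⊔n N₀ _) N≤m) (ℕ.≤-trans (ℕ.m≤m⊔n N₀ _) N≤n))
    (subst (K * _ <_) Kδδ≡ε
      (ℚ.*-monoʳ-<-pos K
        (ℚ.+-mono-<
          (proj₂ A m n (ℕ.≤-trans A≤N N≤m) (ℕ.≤-trans A≤N N≤n))
          (proj₂ B m n (ℕ.≤-trans B≤N N≤m) (ℕ.≤-trans B≤N N≤n)))))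
  where
  instance
    K≢0 : ℚ.NonZero K
    K≢0 = ℚ.pos⇒nonZero K
    ε⁺ : Positive ε
    ε⁺ = positive ε>0
    K⁻¹⁺ : Positive (1/ K)
    K⁻¹⁺ = ℚ.1/pos⇒pos K
  δ : ℚ
  δ = 1/ K * (½ * ε)
  δ>0 : 0ℚ < δ
  δ>0 = ℚ.positive⁻¹ δ {{ℚ.pos*pos⇒pos (1/ K) (½ * ε) {{ℚ.pos*pos⇒pos ½ ε}}}}
  A = ca δ δ>0
  B = cb δ δ>0
  N = N₀ ℕ.⊔ (proj₁ A ℕ.⊔ proj₁ B)
  A≤N : proj₁ A ℕ.≤ N
  A≤N = ℕ.≤-trans (ℕ.m≤m⊔n _ _) (ℕ.m≤n⊔m N₀ _)
  B≤N : proj₁ B ℕ.≤ N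
  B≤N = ℕ.≤-trans (ℕ.m≤n⊔m (proj₁ A) _) (ℕ.m≤n⊔m N₀ _)
  Kδδ≡ε : K * (δ + δ) ≡ ε
  Kδδ≡ε = trans
    (solve 3 (λ k l e → k :* (l :* (con ½ :* e) :+ l :* (con ½ :* e)) := (k :* l) :* e) refl K (1/ K) ε)
    (trans (cong (_* ε) (ℚ.*-inverseʳ K)) (ℚ.*-identityˡ ε))
    where open +-*-Solver

const-cauchy : ∀ q → IsCauchy (const q)
const-cauchy q ε ε>0 = 0 , λ _ _ _ _ → subst (_< ε) (cong ∣_∣ (sym (ℚ.+-inverseʳ q))) ε>0

eventually-bounded : ∀ a → IsCauchy a →
  ∃[ A ] (0ℚ < A × ∃[ N ] (∀ m → N ℕ.≤ m → ∣ a m ∣ ≤ A))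
eventually-bounded a ca = ∣ a N ∣ + 1ℚ , A>0 , N , bd
  where
  N = proj₁ (ca 1ℚ (ℚ.positive⁻¹ 1ℚ))
  A>0 : 0ℚ < ∣ a N ∣ + 1ℚ
  A>0 = ℚ.+-mono-≤-< (ℚ.0≤∣p∣ (a N)) (ℚ.positive⁻¹ 1ℚ)
  bd : ∀ m → N ℕ.≤ m → ∣ a m ∣ ≤ ∣ a N ∣ + 1ℚ
  bd m N≤m = begin
    ∣ a m ∣                ≡⟨ cong ∣_∣ (solve 2 (λ x y → x := y :+ (x :- y)) refl (a m) (a N)) ⟩
    ∣ a N + (a m - a N) ∣  ≤⟨ ℚ.∣p+q∣≤∣p∣+∣q∣ (a N) (a m - a N) ⟩
    ∣ a N ∣ + ∣ a m - a N ∣ ≤⟨ ℚ.+-monoʳ-≤ ∣ a N ∣ (ℚ.<⇒≤ (proj₂ (ca 1ℚ (ℚ.positive⁻¹ 1ℚ)) m N N≤m ℕ.≤-refl)) ⟩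
    ∣ a N ∣ + 1ℚ ∎
    where open ℚ.≤-Reasoning; open +-*-Solver

fromℚ : ℚ → ℝ
fromℚ q = mkℝ (const q) (const-cauchy q)

fromℕ : ℕ → ℝ
fromℕ n = fromℚ (+ n ℚ./ 1)

infixl 6 _-ᴿ_

_-ᴿ_ : ℝ → ℝ → ℝ
mkℝ a ca -ᴿ mkℝ b cb = mkℝ (λ m → a m - b m)
  (dominated a b (λ m → a m - b m) ca cb 1ℚ 0 λ m n _ _ → begin
    ∣ (a m - b m) - (a n - b n) ∣
      ≡⟨ cong ∣_∣ (solve 4 (λ x y z w → (x :- y) :- (z :- w) := (x :- z) :- (y :- w)) refl (a m) (b m) (a n) (b n)) ⟩
    ∣ (a m - a n) - (b m - b n) ∣      ≤⟨ ℚ.∣p-q∣≤∣p∣+∣q∣ (a m - a n) (b m - b n) ⟩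
    ∣ a m - a n ∣ + ∣ b m - b n ∣       ≡⟨ ℚ.*-identityˡ _ ⟨
    1ℚ * (∣ a m - a n ∣ + ∣ b m - b n ∣) ∎)
  where open ℚ.≤-Reasoning; open +-*-Solver

∣∣-lipschitz₁ : ∀ p q → ∣ p ∣ - ∣ q ∣ ≤ ∣ p - q ∣
∣∣-lipschitz₁ p q = begin
  ∣ p ∣ - ∣ q ∣                 ≡⟨ cong (λ r → ∣ r ∣ - ∣ q ∣) (solve 2 (λ x y → x := (x :- y) :+ y) refl p q) ⟩
  ∣ (p - q) + q ∣ - ∣ q ∣        ≤⟨ ℚ.+-monoˡ-≤ (- ∣ q ∣) (ℚ.∣p+q∣≤∣p∣+∣q∣ (p - q) q) ⟩
  (∣ p - q ∣ + ∣ q ∣) - ∣ q ∣    ≡⟨ solve 2 (λ x y → (x :+ y) :- y := x) refl ∣ p - q ∣ ∣ q ∣ ⟩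
  ∣ p - q ∣                     ∎
  where open ℚ.≤-Reasoning; open +-*-Solver

flip-- : ∀ p q → - (p - q) ≡ q - p
flip-- = solve 2 (λ x y → :- (x :- y) := y :- x) refl
  where open +-*-Solver

∣-∣-comm : ∀ p q → ∣ p - q ∣ ≡ ∣ q - p ∣
∣-∣-comm p q = trans (sym (ℚ.∣-p∣≡∣p∣ (p - q))) (cong ∣_∣ (flip-- p q))

∣∣-lipschitz : ∀ p q → ∣ ∣ p ∣ - ∣ q ∣ ∣ ≤ ∣ p - q ∣
∣∣-lipschitz p q with ℚ.∣p∣≡p∨∣p∣≡-p (∣ p ∣ - ∣ q ∣)
... | inj₁ e = subst (_≤ ∣ p - q ∣) (sym e) (∣∣-lipschitz₁ p q)
... | inj₂ e = subst₂ _≤_ (sym (trans e (flip-- ∣ p ∣ ∣ q ∣))) (∣-∣-comm q p) (∣∣-lipschitz₁ q p)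

∣-∣-< : ∀ p q {r} → p - q < r → q - p < r → ∣ p - q ∣ < r
∣-∣-< p q {r} h₁ h₂ with ℚ.∣p∣≡p∨∣p∣≡-p (p - q)
... | inj₁ e = subst (_< r) (sym e) h₁
... | inj₂ e = subst (_< r) (sym (trans e (flip-- p q))) h₂

∣_∣ᴿ : ℝ → ℝ
∣ mkℝ a ca ∣ᴿ = mkℝ (λ m → ∣ a m ∣)
  (dominated a (const 0ℚ) (λ m → ∣ a m ∣) ca (const-cauchy 0ℚ) 1ℚ 0 λ m n _ _ →
    subst (∣ ∣ a m ∣ - ∣ a n ∣ ∣ ≤_)
      (sym (trans (ℚ.*-identityˡ _) (ℚ.+-identityʳ _)))
      (∣∣-lipschitz (a m) (a n)))

infixl 7 _*ᴿ_

_*ᴿ_ : ℝ → ℝ → ℝ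
mkℝ a ca *ᴿ mkℝ b cb = mkℝ (λ m → a m * b m) (c (eventually-bounded a ca) (eventually-bounded b cb))
  where
  open ℚ.≤-Reasoning
  open +-*-Solver
  c : ∃[ A ] (0ℚ < A × ∃[ N ] (∀ m → N ℕ.≤ m → ∣ a m ∣ ≤ A)) →
      ∃[ B ] (0ℚ < B × ∃[ N ] (∀ m → N ℕ.≤ m → ∣ b m ∣ ≤ B)) →
      IsCauchy (λ m → a m * b m)
  c (A , A>0 , M , bdA) (B , B>0 , N , bdB) =
    dominated a b (λ m → a m * b m) ca cb (A + B) {{positive (ℚ.+-mono-< A>0 B>0)}} (M ℕ.⊔ N) λ m n h₁ h₂ → begin
      ∣ a m * b m - a n * b n ∣
        ≡⟨ cong ∣_∣ (solve 4 (λ x y z w → x :* y :- z :* w := x :* (y :- w) :+ w :* (x :- z)) refl (a m) (b m) (a n) (b n)) ⟩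
      ∣ a m * (b m - b n) + b n * (a m - a n) ∣
        ≤⟨ ℚ.∣p+q∣≤∣p∣+∣q∣ (a m * (b m - b n)) (b n * (a m - a n)) ⟩
      ∣ a m * (b m - b n) ∣ + ∣ b n * (a m - a n) ∣
        ≡⟨ cong₂ _+_ (ℚ.∣p*q∣≡∣p∣*∣q∣ (a m) (b m - b n)) (ℚ.∣p*q∣≡∣p∣*∣q∣ (b n) (a m - a n)) ⟩
      ∣ a m ∣ * ∣ b m - b n ∣ + ∣ b n ∣ * ∣ a m - a n ∣
        ≤⟨ ℚ.+-mono-≤
             (scale (b m - b n) (ℚ.≤-trans (bdA m (ℕ.≤-trans (ℕ.m≤m⊔n M N) h₁)) (A≤A+B)))
             (scale (a m - a n) (ℚ.≤-trans (bdB n (ℕ.≤-trans (ℕ.m≤n⊔m M N) h₂)) (B≤A+B))) ⟩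
      (A + B) * ∣ b m - b n ∣ + (A + B) * ∣ a m - a n ∣
        ≡⟨ solve 3 (λ k x y → k :* x :+ k :* y := k :* (y :+ x)) refl (A + B) ∣ b m - b n ∣ ∣ a m - a n ∣ ⟩
      (A + B) * (∣ a m - a n ∣ + ∣ b m - b n ∣) ∎
    where
    scale : ∀ {p q} r → p ≤ q → p * ∣ r ∣ ≤ q * ∣ r ∣
    scale r = ℚ.*-monoʳ-≤-nonNeg ∣ r ∣ {{ℚ.∣-∣-nonNeg r}}
    A≤A+B : A ≤ A + B
    A≤A+B = subst (_≤ A + B) (ℚ.+-identityʳ A) (ℚ.+-monoʳ-≤ A (ℚ.<⇒≤ B>0))
    B≤A+B : B ≤ A + B
    B≤A+B = subst (_≤ A + B) (ℚ.+-identityˡ B) (ℚ.+-monoˡ-≤ B (ℚ.<⇒≤ A>0))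

-- Total reciprocal with the junk value inv 0 = 0; the terms of a positive
-- real are eventually nonzero, so the junk value does not affect division.

inv : ℚ → ℚ
inv q with q ℚ.≟ 0ℚ
... | yes _  = 0ℚ
... | no q≢0 = (1/ q) {{≢-nonZero q≢0}}

inv-inverseʳ : ∀ q → .{{Positive q}} → q * inv q ≡ 1ℚ
inv-inverseʳ q {{q⁺}} with q ℚ.≟ 0ℚ
... | yes q≡0 = contradiction (sym q≡0) (ℚ.<⇒≢ (ℚ.positive⁻¹ q))
... | no q≢0  = ℚ.*-inverseʳ q {{≢-nonZero q≢0}}

inv-pos : ∀ q → .{{Positive q}} → Positive (inv q)
inv-pos q {{q⁺}} with q ℚ.≟ 0ℚ
... | yes q≡0 = contradiction (sym q≡0) (ℚ.<⇒≢ (ℚ.positive⁻¹ q))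
... | no q≢0  = ℚ.1/pos⇒pos q

inv-antimono : ∀ p q → .{{Positive p}} → .{{Positive q}} → p ≤ q → inv q ≤ inv p
inv-antimono p q p≤q = subst₂ _≤_ e₁ e₂
    (ℚ.*-monoˡ-≤-nonNeg (inv p * inv q) {{ℚ.pos⇒nonNeg (inv p * inv q) {{ℚ.pos*pos⇒pos (inv p) {{inv-pos p}} (inv q) {{inv-pos q}}}}}} p≤q)
  where
  open +-*-Solver
  e₁ : inv p * inv q * p ≡ inv q
  e₁ = trans (solve 3 (λ x y z → x :* y :* z := (z :* x) :* y) refl (inv p) (inv q) p)
             (trans (cong (_* inv q) (inv-inverseʳ p)) (ℚ.*-identityˡ (inv q)))
  e₂ : inv p * inv q * q ≡ inv p
  e₂ = trans (solve 3 (λ x y z → x :* y :* z := (z :* y) :* x) refl (inv p) (inv q) q)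
             (trans (cong (_* inv p) (inv-inverseʳ q)) (ℚ.*-identityˡ (inv p)))

inv-lipschitz : ∀ δ p q → 0ℚ < δ → δ ≤ p → δ ≤ q →
  ∣ inv p - inv q ∣ ≤ (inv δ * inv δ) * ∣ p - q ∣
inv-lipschitz δ p q δ>0 δ≤p δ≤q = begin
    ∣ inv p - inv q ∣                     ≡⟨ cong ∣_∣ e ⟩
    ∣ (inv p * inv q) * (q - p) ∣         ≡⟨ ℚ.∣p*q∣≡∣p∣*∣q∣ (inv p * inv q) (q - p) ⟩
    ∣ inv p * inv q ∣ * ∣ q - p ∣         ≡⟨ cong₂ _*_ (ℚ.0≤p⇒∣p∣≡p (ℚ.<⇒≤ (ℚ.positive⁻¹ (inv p * inv q) {{ℚ.pos*pos⇒pos (inv p) (inv q)}}))) (∣-∣-comm q p) ⟩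
    (inv p * inv q) * ∣ p - q ∣           ≤⟨ ℚ.*-monoʳ-≤-nonNeg ∣ p - q ∣ {{ℚ.∣-∣-nonNeg (p - q)}} l ⟩
    (inv δ * inv δ) * ∣ p - q ∣           ∎
  where
  open ℚ.≤-Reasoning
  open +-*-Solver
  instance
    δ⁺ : Positive δ
    δ⁺ = positive δ>0
    p⁺ : Positive p
    p⁺ = positive (ℚ.<-≤-trans δ>0 δ≤p)
    q⁺ : Positive q
    q⁺ = positive (ℚ.<-≤-trans δ>0 δ≤q)
    ip⁺ : Positive (inv p)
    ip⁺ = inv-pos p
    iq⁺ : Positive (inv q)
    iq⁺ = inv-pos q
    iδ⁺ : Positive (inv δ)
    iδ⁺ = inv-pos δ
  e : inv p - inv q ≡ (inv p * inv q) * (q - p)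
  e = sym (trans
    (solve 4 (λ x y z w → (z :* w) :* (y :- x) := (y :* w) :* z :- (x :* z) :* w) refl p q (inv p) (inv q))
    (cong₂ _-_
      (trans (cong (_* inv p) (inv-inverseʳ q)) (ℚ.*-identityˡ (inv p)))
      (trans (cong (_* inv q) (inv-inverseʳ p)) (ℚ.*-identityˡ (inv q)))))
  l : inv p * inv q ≤ inv δ * inv δ
  l = ℚ.≤-trans
    (ℚ.*-monoʳ-≤-nonNeg (inv q) {{ℚ.pos⇒nonNeg (inv q)}} (inv-antimono δ p δ≤p))
    (ℚ.*-monoˡ-≤-nonNeg (inv δ) {{ℚ.pos⇒nonNeg (inv δ)}} (inv-antimono δ q δ≤q))

recip : ∀ x → fromℚ 0ℚ <ᴿ x → ℝ
recip (mkℝ a ca) (δ , δ>0 , N , δ≤) = mkℝ (λ m → inv (a m))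
  (dominated a (const 0ℚ) (λ m → inv (a m)) ca (const-cauchy 0ℚ) (inv δ * inv δ)
    {{ℚ.pos*pos⇒pos (inv δ) {{inv-pos δ {{positive δ>0}}}} (inv δ) {{inv-pos δ {{positive δ>0}}}}}} N
    λ m n N≤m N≤n →
      subst (λ z → ∣ inv (a m) - inv (a n) ∣ ≤ (inv δ * inv δ) * z) (sym (ℚ.+-identityʳ _))
        (inv-lipschitz δ (a m) (a n) δ>0 (δ≤′ m N≤m) (δ≤′ n N≤n)))
  where
  δ≤′ : ∀ m → N ℕ.≤ m → δ ≤ a m
  δ≤′ m N≤m = subst (_≤ a m) (ℚ.+-identityˡ δ) (δ≤ m N≤m)

infixl 7 _/ᴿ_[_]

_/ᴿ_[_] : ∀ x y → fromℚ 0ℚ <ᴿ y → ℝ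
x /ᴿ y [ 0<y ] = x *ᴿ recip y 0<y

-- The limit of a sequence of rationals

infix 4 _⟶_

_⟶_ : (ℕ → ℚ) → ℝ → Set
a ⟶ x = ∀ ε → 0ℚ < ε → ∃[ N ] (∀ j → N ℕ.≤ j → ∣ fromℚ (a j) -ᴿ x ∣ᴿ <ᴿ fromℚ ε)

------------------------------------------------------------------------
-- Binary logarithms of natural numbers

-- For n ≥ 1, ⌊log₂ nˢ⌋ ≤ s · log₂ n < ⌊log₂ nˢ⌋ + 1, so log₂ n is the limit
-- of ⌊log₂ nˢ⌋ / s as s → ∞.  (For n = 0 every term is the junk value 0.)

log₂-seq : ℕ → ℕ → ℚ
log₂-seq n m = + ⌊log₂ (n ℕ.^ suc m) ⌋ ℚ./ suc m

2^⌊log₂⌋≤ : ∀ x → .{{NonZero x}} → 2 ℕ.^ ⌊log₂ x ⌋ ℕ.≤ x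
2^⌊log₂⌋≤ x = <-rec (λ x → 1 ℕ.≤ x → 2 ℕ.^ ⌊log₂ x ⌋ ℕ.≤ x) step x (ℕ.>-nonZero⁻¹ x)
  where
  open ℕ.≤-Reasoning
  step : ∀ x → (∀ {y} → y ℕ.< x → 1 ℕ.≤ y → 2 ℕ.^ ⌊log₂ y ⌋ ℕ.≤ y) → 1 ℕ.≤ x → 2 ℕ.^ ⌊log₂ x ⌋ ℕ.≤ x
  step 1 rec _ = ℕ.≤-refl
  step x@(suc (suc y)) rec _ = begin
    2 ℕ.^ ⌊log₂ x ⌋                   ≤⟨ ℕ.^-monoʳ-≤ 2 (ℕ.m≤n+m∸n ⌊log₂ x ⌋ 1) ⟩
    2 ℕ.* 2 ℕ.^ (⌊log₂ x ⌋ ℕ.∸ 1)     ≡⟨ cong (λ z → 2 ℕ.* 2 ℕ.^ z) (⌊log₂⌊n/2⌋⌋≡⌊log₂n⌋∸1 x) ⟨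
    2 ℕ.* 2 ℕ.^ ⌊log₂ ℕ.⌊ x /2⌋ ⌋     ≤⟨ ℕ.*-monoʳ-≤ 2 (rec (ℕ.⌊n/2⌋<n (suc y)) (s≤s z≤n)) ⟩
    2 ℕ.* ℕ.⌊ x /2⌋                   ≡⟨ cong (ℕ.⌊ x /2⌋ ℕ.+_) (ℕ.+-identityʳ _) ⟩
    ℕ.⌊ x /2⌋ ℕ.+ ℕ.⌊ x /2⌋           ≤⟨ ℕ.+-monoʳ-≤ ℕ.⌊ x /2⌋ (ℕ.⌊n/2⌋≤⌈n/2⌉ x) ⟩
    ℕ.⌊ x /2⌋ ℕ.+ ℕ.⌈ x /2⌉           ≡⟨ ℕ.⌊n/2⌋+⌈n/2⌉≡n x ⟩
    x                                 ∎

<2^suc⌊log₂⌋ : ∀ x → x ℕ.< 2 ℕ.^ suc ⌊log₂ x ⌋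
<2^suc⌊log₂⌋ x = ℕ.≰⇒> λ h → ℕ.<-irrefl refl
  (ℕ.≤-trans (ℕ.≤-reflexive (sym (⌊log₂[2^n]⌋≡n (suc ⌊log₂ x ⌋)))) (⌊log₂⌋-mono-≤ h))

2^-cancel-< : ∀ {p q} → 2 ℕ.^ p ℕ.< 2 ℕ.^ q → p ℕ.< q
2^-cancel-< h = ℕ.≰⇒> λ q≤p → ℕ.<⇒≱ h (ℕ.^-monoʳ-≤ 2 q≤p)

log₂-cross : ∀ n → .{{NonZero n}} → ∀ s t →
  ⌊log₂ (n ℕ.^ suc s) ⌋ ℕ.* suc t ℕ.< suc ⌊log₂ (n ℕ.^ suc t) ⌋ ℕ.* suc s
log₂-cross n s t = 2^-cancel-< (begin-strict
    2 ℕ.^ (p ℕ.* suc t)          ≡⟨ ℕ.^-*-assoc 2 p (suc t) ⟨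
    (2 ℕ.^ p) ℕ.^ suc t          ≤⟨ ℕ.^-monoˡ-≤ (suc t) (2^⌊log₂⌋≤ (n ℕ.^ suc s) {{ℕ.m^n≢0 n (suc s)}}) ⟩
    (n ℕ.^ suc s) ℕ.^ suc t      ≡⟨ ℕ.^-*-assoc n (suc s) (suc t) ⟩
    n ℕ.^ (suc s ℕ.* suc t)      ≡⟨ cong (n ℕ.^_) (ℕ.*-comm (suc s) (suc t)) ⟩
    n ℕ.^ (suc t ℕ.* suc s)      ≡⟨ ℕ.^-*-assoc n (suc t) (suc s) ⟨
    (n ℕ.^ suc t) ℕ.^ suc s      <⟨ ℕ.^-monoˡ-< (suc s) (<2^suc⌊log₂⌋ (n ℕ.^ suc t)) ⟩
    (2 ℕ.^ suc q) ℕ.^ suc s      ≡⟨ ℕ.^-*-assoc 2 (suc q) (suc s) ⟩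
    2 ℕ.^ (suc q ℕ.* suc s)      ∎)
  where
  open ℕ.≤-Reasoning
  p = ⌊log₂ (n ℕ.^ suc s) ⌋
  q = ⌊log₂ (n ℕ.^ suc t) ⌋

toℚᵘ-/ : ∀ p d → ℚ.toℚᵘ (p ℚ./ suc d) ℚᵘ.≃ ℚᵘ.mkℚᵘ p d
toℚᵘ-/ p d = ℚ.toℚᵘ-fromℚᵘ (ℚᵘ.mkℚᵘ p d)

/-mono-< : ∀ p q s t → p ℕ.* suc t ℕ.< q ℕ.* suc s → (+ p ℚ./ suc s) < (+ q ℚ./ suc t)
/-mono-< p q s t h = ℚ.toℚᵘ-cancel-<
  (ℚᵘ.<-respˡ-≃ (ℚᵘ.≃-sym (toℚᵘ-/ (+ p) s))
    (ℚᵘ.<-respʳ-≃ (ℚᵘ.≃-sym (toℚᵘ-/ (+ q) t))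
      (ℚᵘ.*<* (subst₂ ℤ._<_ (ℤ.pos-* p (suc t)) (ℤ.pos-* q (suc s)) (ℤ.+<+ h)))))

/-mono-≤ : ∀ p q s t → p ℕ.* suc t ℕ.≤ q ℕ.* suc s → (+ p ℚ./ suc s) ≤ (+ q ℚ./ suc t)
/-mono-≤ p q s t h = ℚ.toℚᵘ-cancel-≤
  (ℚᵘ.≤-respˡ-≃ (ℚᵘ.≃-sym (toℚᵘ-/ (+ p) s))
    (ℚᵘ.≤-respʳ-≃ (ℚᵘ.≃-sym (toℚᵘ-/ (+ q) t))
      (ℚᵘ.*≤* (subst₂ ℤ._≤_ (ℤ.pos-* p (suc t)) (ℤ.pos-* q (suc s)) (ℤ.+≤+ h)))))

/-suc : ∀ q t → (+ suc q ℚ./ suc t) ≡ (+ 1 ℚ./ suc t) + (+ q ℚ./ suc t)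
/-suc q t = ℚ.toℚᵘ-injective (begin
  ℚ.toℚᵘ (+ suc q ℚ./ suc t)                             ≈⟨ toℚᵘ-/ (+ suc q) t ⟩
  ℚᵘ.mkℚᵘ (+ suc q) t                                    ≈⟨ ℚᵘ.*≡* (solve 2 (λ x d → (con (+ 1) :+ x) :* (d :* d) := (con (+ 1) :* d :+ x :* d) :* d) refl (+ q) (+ suc t)) ⟩
  ℚᵘ.mkℚᵘ (+ 1) t ℚᵘ.+ ℚᵘ.mkℚᵘ (+ q) t                    ≈⟨ ℚᵘ.+-cong (toℚᵘ-/ (+ 1) t) (toℚᵘ-/ (+ q) t) ⟨
  ℚ.toℚᵘ (+ 1 ℚ./ suc t) ℚᵘ.+ ℚ.toℚᵘ (+ q ℚ./ suc t)     ≈⟨ ℚ.toℚᵘ-homo-+ (+ 1 ℚ./ suc t) (+ q ℚ./ suc t) ⟨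
  ℚ.toℚᵘ ((+ 1 ℚ./ suc t) + (+ q ℚ./ suc t))             ∎)
  where open ℚᵘ.≃-Reasoning; open ℤSolver.+-*-Solver

archimedean : ∀ ε → 0ℚ < ε → ∃[ N ] ((+ 1 ℚ./ suc N) < ε)
archimedean ε ε>0 = go ε (positive ε>0)
  where
  go : ∀ ε → Positive ε → ∃[ N ] ((+ 1 ℚ./ suc N) < ε)
  go ε@(mkℚ +[1+ p ] d _) _ = suc d , subst (_ <_) (ℚ.fromℚᵘ-toℚᵘ ε)
    (/-mono-< 1 (suc p) (suc d) d
      (ℕ.≤-trans (ℕ.≤-reflexive (cong (suc ∘ suc) (ℕ.+-identityʳ d))) (ℕ.m≤m+n (suc (suc d)) _)))

log₂-step : ∀ n → .{{NonZero n}} → ∀ N s t → N ℕ.≤ t → log₂-seq n s - log₂-seq n t < + 1 ℚ./ suc N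
log₂-step n N s t N≤t = begin-strict
  log₂-seq n s - log₂-seq n t
    <⟨ ℚ.+-monoˡ-< (- log₂-seq n t) (/-mono-< ⌊log₂ (n ℕ.^ suc s) ⌋ (suc ⌊log₂ (n ℕ.^ suc t) ⌋) s t (log₂-cross n s t)) ⟩
  (+ suc ⌊log₂ (n ℕ.^ suc t) ⌋ ℚ./ suc t) - log₂-seq n t
    ≡⟨ cong (_- log₂-seq n t) (/-suc ⌊log₂ (n ℕ.^ suc t) ⌋ t) ⟩
  (+ 1 ℚ./ suc t) + log₂-seq n t - log₂-seq n t
    ≡⟨ solve 2 (λ x y → (x :+ y) :- y := x) refl (+ 1 ℚ./ suc t) (log₂-seq n t) ⟩
  + 1 ℚ./ suc t
    ≤⟨ /-mono-≤ 1 1 t N (ℕ.+-monoˡ-≤ 0 (s≤s N≤t)) ⟩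
  + 1 ℚ./ suc N ∎
  where open ℚ.≤-Reasoning; open +-*-Solver

log₂-close : ∀ n → .{{NonZero n}} → ∀ N s t → N ℕ.≤ s → N ℕ.≤ t →
  ∣ log₂-seq n s - log₂-seq n t ∣ < + 1 ℚ./ suc N
log₂-close n N s t N≤s N≤t = ∣-∣-< (log₂-seq n s) (log₂-seq n t) (log₂-step n N s t N≤t) (log₂-step n N t s N≤s)

log₂-cauchy₊ : ∀ n → .{{NonZero n}} → IsCauchy (log₂-seq n)
log₂-cauchy₊ n ε ε>0 = N , λ s t N≤s N≤t → ℚ.<-trans (log₂-close n N s t N≤s N≤t) 1/N<ε
  where
  N = proj₁ (archimedean ε ε>0)
  1/N<ε = proj₂ (archimedean ε ε>0)

log₂-seq-zero : ∀ m → log₂-seq 0 m ≡ 0ℚ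
log₂-seq-zero m = ℚ.0/n≡0 (suc m)

log₂-cauchy : ∀ n → IsCauchy (log₂-seq n)
log₂-cauchy zero    ε ε>0 = 0 , λ s t _ _ →
  subst (_< ε) (sym (cong₂ (λ x y → ∣ x - y ∣) (log₂-seq-zero s) (log₂-seq-zero t))) ε>0
log₂-cauchy (suc n) = log₂-cauchy₊ (suc n)

log₂ : ℕ → ℝ
log₂ n = mkℝ (log₂-seq n) (log₂-cauchy n)

0<log₂ : ∀ {k} → 1 ℕ.< k → fromℚ 0ℚ <ᴿ log₂ k
0<log₂ {k} 1<k = 1ℚ , ℚ.positive⁻¹ 1ℚ , 0 , λ m _ →
  subst (_≤ log₂-seq k m) (sym (ℚ.+-identityˡ 1ℚ))
    (/-mono-≤ 1 ⌊log₂ (k ℕ.^ suc m) ⌋ 0 m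
      (subst₂ ℕ._≤_ (sym (ℕ.*-identityˡ (suc m))) (sym (ℕ.*-identityʳ ⌊log₂ (k ℕ.^ suc m) ⌋))
      (subst (ℕ._≤ ⌊log₂ (k ℕ.^ suc m) ⌋) (⌊log₂[2^n]⌋≡n (suc m)) (⌊log₂⌋-mono-≤ (ℕ.^-monoˡ-≤ (suc m) 1<k)))))

infix 8 2^-_

2^-_ : ℕ → ℚ
2^- n = (+ 1 ℚ./ 2 ℕ.^ n) {{ℕ.m^n≢0 2 n}}

module Submission where

-- The proof is Fourier analysis on the additive group of linear functions
-- over GF(2).
--
-- For s = (t , x) in GF(2)^(n+1) the map χ s sends a Boolean function g to the
-- sign (-1)^(t g(0) + g(0) + g(x)).  On the linear functions these are all
-- 2^(n+1) characters.  Write aᵢ(s) for the expectation of χ s under πᵢ.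
-- Since the connective is c ⊕ y₁ ⊕ ... ⊕ y_k, one step of the process sends aᵢ
-- to aᵢ₊₁ = ±aᵢ^k with a sign that does not depend on i (`transform-suc`), and
-- since πᵢ lives on linear functions it is recovered by
-- 2^(n+1) πᵢ(f) = ∑ₛ χ s f · aᵢ(s) (`inversion`).
--
-- The coefficient a₀(s) is an average of N signs with N ≤ 2n+2.  Either all
-- these signs agree and a₀(s) = ±1, or at least one of them differs from the
-- others and |a₀(s)| ≤ (N-2)/N ≤ n/(n+1) (`𝔼-μ-χ`).
--   * If a₀(s) = ±1, then aᵢ(s) is the orbit of a sign under a fixed map of the
--     two-element set {±1}; every such map τ satisfies τ³ = τ, so aᵢ(s) has
--     period 2 from i = 1 on (`transform-periodic`).
--   * Otherwise |aᵢ(s)| = |a₀(s)|^(k^i), and since k^i > n² this is at most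
--     r = (n/(n+1))^(n²+1), and the same holds at all later times
--     (`transform-decay`).
-- Hence, for i ≥ 1 and j - i even and nonnegative, each character other than
-- the trivial one contributes at most 2r to 2^(n+1) (πⱼ(f) - πᵢ(f)), and the
-- trivial one contributes nothing.  So 2^(n+1) |πⱼ(f) - πᵢ(f)| is at most
-- (2^(n+1) - 1) · 2r, which is less than 2 by the elementary inequality
-- `power-bound`.  Letting j tend to infinity along the times of the same parity
-- as i gives the theorem (`growth-close`, `⟶-close`).  No case distinction is
-- needed for the coefficients that oscillate with period exactly 2, which the
-- existence of the limit excludes: the comparison does not see them.

open import Algebra.Bundles using (CommutativeRing)
open import Data.Bool using (Bool; true; false; not; _∧_; _xor_; if_then_else_)
import Data.Bool.Properties as Bool
import Data.Bool.Solver as BoolSolver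
open import Data.Fin using (Fin; zero; suc)
import Data.Integer as ℤ
import Data.Integer.Properties as ℤ
import Data.Integer.Solver as ℤSolver
open import Data.List as List using (List; []; _∷_; _++_; length; cartesianProductWith; filter)
import Data.List.Properties as List
open import Data.List.Relation.Unary.All as All using (All; []; _∷_)
import Data.List.Relation.Unary.All.Properties as All
open import Data.List.Relation.Unary.AllPairs as AllPairs using (AllPairs; []; _∷_)
import Data.List.Relation.Unary.AllPairs.Properties as AllPairs
open import Data.List.Relation.Unary.Any as Any using (any?; here; there)
open import Data.Nat as ℕ using (ℕ; zero; suc; NonZero; _<_; z≤n)
open import Data.Nat.Logarithm using (⌊log₂_⌋; ⌊log₂⌋-mono-≤; ⌊log₂[2^n]⌋≡n)
import Data.Nat.Properties as ℕ
import Data.Nat.Solver as ℕSolver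
open import Data.Product using (∃-syntax; _×_; _,_; proj₁; proj₂)
open import Data.Rational as ℚ using (ℚ; 0ℚ; 1ℚ; ½; _+_; _*_; _-_; -_; ∣_∣; _≤_)
import Data.Rational.Properties as ℚ
open import Data.Rational.Solver using (module +-*-Solver)
import Data.Rational.Unnormalised as ℚᵘ
import Data.Rational.Unnormalised.Properties as ℚᵘ
open import Data.Sum using (_⊎_; inj₁; inj₂; [_,_]′)
open import Data.Vec as Vec using (Vec; []; _∷_; lookup; zipWith; replicate; _[_]≔_)
import Data.Vec.Properties as Vec
open import Data.Vec.Relation.Unary.All as VecAll using ([]; _∷_)
open import Function using (_∘_; const; id)
open import Relation.Binary.PropositionalEquality
open import Relation.Nullary using (Dec; yes; no; does; ¬_; contradiction)
open import Defs

open import Algebra.Properties.CommutativeSemiring.Exp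
  (CommutativeRing.commutativeSemiring ℚ.+-*-commutativeRing) using (_^_; ^-assocʳ)

------------------------------------------------------------------------
-- An elementary inequality for powers

^-distribʳ-* : ∀ m a b → (a ℕ.* b) ℕ.^ m ≡ a ℕ.^ m ℕ.* b ℕ.^ m
^-distribʳ-* zero    a b = refl
^-distribʳ-* (suc m) a b = trans (cong (a ℕ.* b ℕ.*_) (^-distribʳ-* m a b))
  (solve 4 (λ a b x y → a :* b :* (x :* y) := a :* x :* (b :* y)) refl a b (a ℕ.^ m) (b ℕ.^ m))
  where
  open ℕSolver.+-*-Solver

-- Bernoulli's inequality (1 + b/a)^m ≥ 1 + m b/a, with denominators cleared.
bernoulli : ∀ a b m → a ℕ.^ m ℕ.* (a ℕ.+ m ℕ.* b) ℕ.≤ (a ℕ.+ b) ℕ.^ m ℕ.* a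
bernoulli a b zero    = ℕ.≤-reflexive (cong (1 ℕ.*_) (ℕ.+-identityʳ a))
bernoulli a b (suc m) = begin
  a ℕ.* x ℕ.* (a ℕ.+ (b ℕ.+ m ℕ.* b))
    ≤⟨ ℕ.m≤m+n _ (x ℕ.* (m ℕ.* b ℕ.* b)) ⟩
  a ℕ.* x ℕ.* (a ℕ.+ (b ℕ.+ m ℕ.* b)) ℕ.+ x ℕ.* (m ℕ.* b ℕ.* b)
    ≡⟨ solve 4 (λ a b m x → a :* x :* (a :+ (b :+ m :* b)) :+ x :* (m :* b :* b)
           := (a :+ b) :* (x :* (a :+ m :* b))) refl a b m x ⟩
  (a ℕ.+ b) ℕ.* (x ℕ.* (a ℕ.+ m ℕ.* b))
    ≤⟨ ℕ.*-monoʳ-≤ (a ℕ.+ b) (bernoulli a b m) ⟩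
  (a ℕ.+ b) ℕ.* ((a ℕ.+ b) ℕ.^ m ℕ.* a)
    ≡⟨ ℕ.*-assoc (a ℕ.+ b) _ a ⟨
  (a ℕ.+ b) ℕ.* (a ℕ.+ b) ℕ.^ m ℕ.* a ∎
  where
  open ℕ.≤-Reasoning
  open ℕSolver.+-*-Solver
  x = a ℕ.^ m

-- The binomial expansion (1 + 1/n)^m ≥ 1 + m/n + m(m-1)/(2n²) up to second
-- order, with denominators cleared and the negative term moved to the right.
bernoulli₂ : ∀ n m →
  n ℕ.^ m ℕ.* (2 ℕ.* (n ℕ.* n) ℕ.+ 2 ℕ.* (n ℕ.* m) ℕ.+ m ℕ.* m) ℕ.≤
  suc n ℕ.^ m ℕ.* (2 ℕ.* (n ℕ.* n)) ℕ.+ m ℕ.* n ℕ.^ m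
bernoulli₂ n zero    = ℕ.≤-reflexive
  (solve 1 (λ n → con 1 :* (con 2 :* (n :* n) :+ con 2 :* (n :* con 0) :+ con 0)
         := con 1 :* (con 2 :* (n :* n)) :+ con 0) refl n)
  where
  open ℕSolver.+-*-Solver
bernoulli₂ n (suc m) = ℕ.+-cancelʳ-≤ (suc n ℕ.* (m ℕ.* x)) _ _ (begin
  n ℕ.* x ℕ.* (2 ℕ.* (n ℕ.* n) ℕ.+ 2 ℕ.* (n ℕ.* suc m) ℕ.+ suc m ℕ.* suc m) ℕ.+ suc n ℕ.* (m ℕ.* x)
    ≡⟨ solve 3 (λ n m x →
         n :* x :* (con 2 :* (n :* n) :+ con 2 :* (n :* (con 1 :+ m)) :+ (con 1 :+ m) :* (con 1 :+ m)) :+ (con 1 :+ n) :* (m :* x)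
        
                := m :* x :+ ((n :* (x :* (con 2 :* (n :* n) :+ con 2 :* (n :* m) :+ m :* m))) :+ x :* (con 2 :* (n :* n) :+ con 2 :* (n :* m)) :+ n :* x :+ n :* m :* x)) refl n m x ⟩
  m ℕ.* x ℕ.+ rest
    ≤⟨ ℕ.+-monoˡ-≤ rest (ℕ.*-monoˡ-≤ x (m≤m² m)) ⟩
  m ℕ.* m ℕ.* x ℕ.+ rest
    ≡⟨ solve 3 (λ n m x →
         m :* m :* x :+ ((n :* (x :* (con 2 :* (n :* n) :+ con 2 :* (n :* m) :+ m :* m))) :+ x :* (con 2 :* (n :* n) :+ con 2 :* (n :* m)) :+ n :* x :+ n :* m :* x)
        
                := (con 1 :+ n) :* (x :* (con 2 :* (n :* n) :+ con 2 :* (n :* m) :+ m :* m)) :+ (con 1 :+ m) :* (n :* x)) refl n m x ⟩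
  suc n ℕ.* (x ℕ.* (2 ℕ.* (n ℕ.* n) ℕ.+ 2 ℕ.* (n ℕ.* m) ℕ.+ m ℕ.* m)) ℕ.+ suc m ℕ.* (n ℕ.* x)
    ≤⟨ ℕ.+-monoˡ-≤ (suc m ℕ.* (n ℕ.* x)) (ℕ.*-monoʳ-≤ (suc n) (bernoulli₂ n m)) ⟩
  suc n ℕ.* (y ℕ.* (2 ℕ.* (n ℕ.* n)) ℕ.+ m ℕ.* x) ℕ.+ suc m ℕ.* (n ℕ.* x)
    ≡⟨ solve 4 (λ n m x y → (con 1 :+ n) :* (y :* (con 2 :* (n :* n)) :+ m :* x) :+ (con 1 :+ m) :* (n :* x)
        
                := (con 1 :+ n) :* y :* (con 2 :* (n :* n)) :+ (con 1 :+ m) :* (n :* x) :+ (con 1 :+ n) :* (m :* x)) refl n m x y ⟩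
  suc n ℕ.* y ℕ.* (2 ℕ.* (n ℕ.* n)) ℕ.+ suc m ℕ.* (n ℕ.* x) ℕ.+ suc n ℕ.* (m ℕ.* x) ∎)
  where
  open ℕ.≤-Reasoning
  open ℕSolver.+-*-Solver
  x = n ℕ.^ m
  y = suc n ℕ.^ m
  rest = (n ℕ.* (x ℕ.* (2 ℕ.* (n ℕ.* n) ℕ.+ 2 ℕ.* (n ℕ.* m) ℕ.+ m ℕ.* m)))
    ℕ.+ x ℕ.* (2 ℕ.* (n ℕ.* n) ℕ.+ 2 ℕ.* (n ℕ.* m)) ℕ.+ n ℕ.* x ℕ.+ n ℕ.* m ℕ.* x
  m≤m² : ∀ m → m ℕ.≤ m ℕ.* m
  m≤m² zero    = z≤n
  m≤m² (suc m) = ℕ.m≤m*n (suc m) (suc m)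

-- The case m = n of the second-order bound: (1 + 1/n)^n ≥ (5n-1)/(2n).  With
-- n = p + 1, the numerator 5n - 1 is 4n + p.
growth-ratio : ∀ p → let n = suc p in
  (4 ℕ.* n ℕ.+ p) ℕ.* n ℕ.^ n ℕ.≤ (2 ℕ.* n) ℕ.* suc n ℕ.^ n
growth-ratio p = ℕ.*-cancelˡ-≤ n (ℕ.+-cancelʳ-≤ (n ℕ.* x) _ _ (begin
  n ℕ.* ((4 ℕ.* n ℕ.+ p) ℕ.* x) ℕ.+ n ℕ.* x
    ≡⟨ solve 2 (λ p x → (con 1 :+ p) :* ((con 4 :* (con 1 :+ p) :+ p) :* x) :+ (con 1 :+ p) :* x
        
                := x :* (con 2 :* ((con 1 :+ p) :* (con 1 :+ p)) :+ con 2 :* ((con 1 :+ p) :* (con 1 :+ p)) :+ (con 1 :+ p) :* (con 1 :+ p))) refl p x ⟩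
  x ℕ.* (2 ℕ.* (n ℕ.* n) ℕ.+ 2 ℕ.* (n ℕ.* n) ℕ.+ n ℕ.* n)
    ≤⟨ bernoulli₂ n n ⟩
  y ℕ.* (2 ℕ.* (n ℕ.* n)) ℕ.+ n ℕ.* x
    ≡⟨ cong (ℕ._+ n ℕ.* x) (solve 2 (λ n y → y :* (con 2 :* (n :* n)) := n :* (con 2 :* n :* y)) refl n y) ⟩
  n ℕ.* (2 ℕ.* n ℕ.* y) ℕ.+ n ℕ.* x ∎))
  where
  open ℕ.≤-Reasoning
  open ℕSolver.+-*-Solver
  n = suc p
  x = n ℕ.^ n
  y = suc n ℕ.^ n

-- The n-th power of the preceding bound, with (5n-1)/(4n) = 1 + p/(4n) expanded
-- by Bernoulli: (1 + 1/n)^(n²) ≥ 2^n (1 + p/4).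
growth-ratio^ : ∀ p → let n = suc p in
  (2 ℕ.^ n ℕ.* (4 ℕ.+ p)) ℕ.* n ℕ.^ (n ℕ.* n) ℕ.≤ 4 ℕ.* suc n ℕ.^ (n ℕ.* n)
growth-ratio^ p = ℕ.*-cancelˡ-≤ c {{ℕ.m*n≢0 n ((2 ℕ.* n) ℕ.^ n) {{_}} {{ℕ.m^n≢0 (2 ℕ.* n) n}}}} (begin
  c ℕ.* ((2 ℕ.^ n ℕ.* (4 ℕ.+ p)) ℕ.* n ℕ.^ (n ℕ.* n))
    ≡⟨ cong (λ z → c ℕ.* ((2 ℕ.^ n ℕ.* (4 ℕ.+ p)) ℕ.* z)) (sym (ℕ.^-*-assoc n n n)) ⟩
  n ℕ.* (2 ℕ.* n) ℕ.^ n ℕ.* ((2 ℕ.^ n ℕ.* (4 ℕ.+ p)) ℕ.* x ℕ.^ n)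
    ≡⟨ solve 5 (λ n t u p z → n :* t :* ((u :* (con 4 :+ p)) :* z)
           := (u :* t) :* (con 4 :* n :+ n :* p) :* z) refl n ((2 ℕ.* n) ℕ.^ n) (2 ℕ.^ n) p (x ℕ.^ n) ⟩
  (2 ℕ.^ n ℕ.* (2 ℕ.* n) ℕ.^ n) ℕ.* (4 ℕ.* n ℕ.+ n ℕ.* p) ℕ.* x ℕ.^ n
    ≡⟨ cong (λ z → z ℕ.* (4 ℕ.* n ℕ.+ n ℕ.* p) ℕ.* x ℕ.^ n) (trans (sym (^-distribʳ-* n 2 (2 ℕ.* n))) (cong (ℕ._^ n) (sym (ℕ.*-assoc 2 2 n)))) ⟩
  (4 ℕ.* n) ℕ.^ n ℕ.* (4 ℕ.* n ℕ.+ n ℕ.* p) ℕ.* x ℕ.^ n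
    ≤⟨ ℕ.*-monoˡ-≤ (x ℕ.^ n) (bernoulli (4 ℕ.* n) p n) ⟩
  (4 ℕ.* n ℕ.+ p) ℕ.^ n ℕ.* (4 ℕ.* n) ℕ.* x ℕ.^ n
    ≡⟨ solve 3 (λ a n z → a :* (con 4 :* n) :* z
           := con 4 :* n :* (a :* z)) refl ((4 ℕ.* n ℕ.+ p) ℕ.^ n) n (x ℕ.^ n) ⟩
  4 ℕ.* n ℕ.* ((4 ℕ.* n ℕ.+ p) ℕ.^ n ℕ.* x ℕ.^ n)
    ≡⟨ cong (4 ℕ.* n ℕ.*_) (sym (^-distribʳ-* n (4 ℕ.* n ℕ.+ p) x)) ⟩
  4 ℕ.* n ℕ.* ((4 ℕ.* n ℕ.+ p) ℕ.* x) ℕ.^ n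
    ≤⟨ ℕ.*-monoʳ-≤ (4 ℕ.* n) (ℕ.^-monoˡ-≤ n (growth-ratio p)) ⟩
  4 ℕ.* n ℕ.* (2 ℕ.* n ℕ.* y) ℕ.^ n
    ≡⟨ cong (4 ℕ.* n ℕ.*_) (^-distribʳ-* n (2 ℕ.* n) y) ⟩
  4 ℕ.* n ℕ.* ((2 ℕ.* n) ℕ.^ n ℕ.* y ℕ.^ n)
    ≡⟨ solve 3 (λ n t z → con 4 :* n :* (t :* z) := n :* t :* (con 4 :* z)) refl n ((2 ℕ.* n) ℕ.^ n) (y ℕ.^ n) ⟩
  c ℕ.* (4 ℕ.* y ℕ.^ n)
    ≡⟨ cong (λ z → c ℕ.* (4 ℕ.* z)) (ℕ.^-*-assoc (suc n) n n) ⟩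
  c ℕ.* (4 ℕ.* suc n ℕ.^ (n ℕ.* n)) ∎)
  where
  open ℕ.≤-Reasoning
  open ℕSolver.+-*-Solver
  n = suc p
  x = n ℕ.^ n
  y = suc n ℕ.^ n
  c = n ℕ.* (2 ℕ.* n) ℕ.^ n

-- For n other than 2 even 2^(n+1) n^(n²+1) ≤ (n+1)^(n²+1) holds; it follows from
-- the preceding bound since (p+2)(p+4) ≥ 8(p+1) unless p = 1.  For n = 2 the second
-- term on the right is needed: 256 < 243 + 32.
power-bound : ∀ p → let n = suc p in
  2 ℕ.^ suc n ℕ.* n ℕ.^ suc (n ℕ.* n) ℕ.< suc n ℕ.^ suc (n ℕ.* n) ℕ.+ n ℕ.^ suc (n ℕ.* n)
-- For n = 1 and n = 2 the inequality is checked numerically.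
power-bound 1 = ℕ.<ᵇ⇒< _ _ _
power-bound 0 = ℕ.<ᵇ⇒< _ _ _
power-bound p@(suc (suc r)) = ℕ.≤-<-trans (ℕ.*-cancelˡ-≤ 4 (begin
  4 ℕ.* (2 ℕ.* u ℕ.* (n ℕ.* x))
    ≡⟨ solve 3 (λ p u x → con 4 :* (con 2 :* u :* ((con 1 :+ p) :* x))
           := con 8 :* (con 1 :+ p) :* (u :* x)) refl p u x ⟩
  8 ℕ.* suc p ℕ.* (u ℕ.* x)
    ≤⟨ ℕ.m≤m+n _ ((r ℕ.* r ℕ.+ 2 ℕ.* r) ℕ.* (u ℕ.* x)) ⟩
  8 ℕ.* suc p ℕ.* (u ℕ.* x) ℕ.+ (r ℕ.* r ℕ.+ 2 ℕ.* r) ℕ.* (u ℕ.* x)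
    ≡⟨ solve 3 (λ r u x → con 8 :* (con 3 :+ r) :* (u :* x) :+ (r :* r :+ con 2 :* r) :* (u :* x)
           := (con 4 :+ r) :* (u :* (con 6 :+ r) :* x)) refl r u x ⟩
  suc n ℕ.* (u ℕ.* (4 ℕ.+ p) ℕ.* x)
    ≤⟨ ℕ.*-monoʳ-≤ (suc n) (growth-ratio^ p) ⟩
  suc n ℕ.* (4 ℕ.* y)
    ≡⟨ solve 2 (λ n y → n :* (con 4 :* y) := con 4 :* (n :* y)) refl (suc n) y ⟩
  4 ℕ.* (suc n ℕ.* y) ∎))
  (ℕ.m<m+n (suc n ℕ.* y) (ℕ.m^n>0 n (suc (n ℕ.* n))))
  where
  open ℕ.≤-Reasoning
  open ℕSolver.+-*-Solver
  n = suc p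
  u = 2 ℕ.^ n
  x = n ℕ.^ (n ℕ.* n)
  y = suc n ℕ.^ (n ℕ.* n)

------------------------------------------------------------------------
-- Finite sums of rationals

private variable
  A B C : Set
  n k : ℕ

-- The sum of F over the entries of a list, counted with multiplicity.
∑ : List A → (A → ℚ) → ℚ
∑ xs F = sumℚ (List.map F xs)

∑-cong : ∀ (xs : List A) {F G} → (∀ x → F x ≡ G x) → ∑ xs F ≡ ∑ xs G
∑-cong []       e = refl
∑-cong (x ∷ xs) e = cong₂ _+_ (e x) (∑-cong xs e)

∑-++ : ∀ (xs ys : List A) F → ∑ (xs ++ ys) F ≡ ∑ xs F + ∑ ys F
∑-++ []       ys F = sym (ℚ.+-identityˡ _)
∑-++ (x ∷ xs) ys F = trans (cong (F x +_) (∑-++ xs ys F)) (sym (ℚ.+-assoc (F x) _ _))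

∑-map : ∀ (f : A → B) xs F → ∑ (List.map f xs) F ≡ ∑ xs (F ∘ f)
∑-map f []       F = refl
∑-map f (x ∷ xs) F = cong (F (f x) +_) (∑-map f xs F)

∑-product : ∀ (f : A → B → C) xs ys F →
  ∑ (cartesianProductWith f xs ys) F ≡ ∑ xs (λ x → ∑ ys (λ y → F (f x y)))
∑-product f []       ys F = refl
∑-product f (x ∷ xs) ys F = trans (∑-++ (List.map (f x) ys) _ F)
  (cong₂ _+_ (∑-map (f x) ys F) (∑-product f xs ys F))

∑-zero : ∀ (xs : List A) → ∑ xs (const 0ℚ) ≡ 0ℚ
∑-zero []       = refl
∑-zero (x ∷ xs) = trans (ℚ.+-identityˡ _) (∑-zero xs)

∑-+ : ∀ (xs : List A) F G → ∑ xs (λ x → F x + G x) ≡ ∑ xs F + ∑ xs G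
∑-+ []       F G = refl
∑-+ (x ∷ xs) F G = trans (cong (F x + G x +_) (∑-+ xs F G))
  (solve 4 (λ a b c d → (a :+ b) :+ (c :+ d) := (a :+ c) :+ (b :+ d)) refl (F x) (G x) _ _)
  where
  open +-*-Solver

∑-*ˡ : ∀ (xs : List A) c F → ∑ xs (λ x → c * F x) ≡ c * ∑ xs F
∑-*ˡ []       c F = sym (ℚ.*-zeroʳ c)
∑-*ˡ (x ∷ xs) c F = trans (cong (c * F x +_) (∑-*ˡ xs c F)) (sym (ℚ.*-distribˡ-+ c (F x) _))

∑-*ʳ : ∀ (xs : List A) c F → ∑ xs (λ x → F x * c) ≡ ∑ xs F * c
∑-*ʳ xs c F = trans (∑-cong xs (λ x → ℚ.*-comm (F x) c)) (trans (∑-*ˡ xs c F) (ℚ.*-comm c _))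

∑-swap : ∀ (xs : List A) (ys : List B) (F : A → B → ℚ) →
  ∑ xs (λ x → ∑ ys (F x)) ≡ ∑ ys (λ y → ∑ xs (λ x → F x y))
∑-swap []       ys F = sym (∑-zero ys)
∑-swap (x ∷ xs) ys F = trans (cong (∑ ys (F x) +_) (∑-swap xs ys F)) (sym (∑-+ ys (F x) _))

∑-mono : ∀ (xs : List A) {F G} → (∀ x → F x ≤ G x) → ∑ xs F ≤ ∑ xs G
∑-mono []       h = ℚ.≤-refl
∑-mono (x ∷ xs) h = ℚ.+-mono-≤ (h x) (∑-mono xs h)

∣∑∣≤∑∣∣ : ∀ (xs : List A) F → ∣ ∑ xs F ∣ ≤ ∑ xs (λ x → ∣ F x ∣)
∣∑∣≤∑∣∣ []       F = ℚ.≤-refl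
∣∑∣≤∑∣∣ (x ∷ xs) F = ℚ.≤-trans (ℚ.∣p+q∣≤∣p∣+∣q∣ (F x) _) (ℚ.+-monoʳ-≤ ∣ F x ∣ (∣∑∣≤∑∣∣ xs F))

∑≢0⇒∃ : ∀ (xs : List A) F → ∑ xs F ≢ 0ℚ → ∃[ x ] F x ≢ 0ℚ
∑≢0⇒∃ []       F h = contradiction refl h
∑≢0⇒∃ (x ∷ xs) F h with F x ℚ.≟ 0ℚ
... | no Fx≢0  = x , Fx≢0
... | yes Fx≡0 = ∑≢0⇒∃ xs F λ e → h (cong₂ _+_ Fx≡0 e)

------------------------------------------------------------------------
-- Natural numbers and powers in the rationals

-- The embedding of the naturals into the rationals.  It is opaque because the
-- normalising quotient _/_ would otherwise unfold into gcd computations on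
-- open terms such as 2 ^ suc n.
opaque
  ι : ℕ → ℚ
  ι m = ℤ.+ m ℚ./ 1

  ι-def : ∀ m → ι m ≡ ℤ.+ m ℚ./ 1
  ι-def m = refl

  ι-0 : ι 0 ≡ 0ℚ
  ι-0 = refl

  ι-1 : ι 1 ≡ 1ℚ
  ι-1 = refl

  ι-mono-≤ : ∀ {a b} → a ℕ.≤ b → ι a ≤ ι b
  ι-mono-≤ {a} {b} a≤b = /-mono-≤ a b 0 0 (ℕ.*-monoˡ-≤ 1 a≤b)

  ι-mono-< : ∀ {a b} → a < b → ι a ℚ.< ι b
  ι-mono-< {a} {b} a<b = /-mono-< a b 0 0 (ℕ.*-monoˡ-< 1 a<b)

  ι-+ : ∀ a b → ι (a ℕ.+ b) ≡ ι a + ι b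
  ι-+ a b = ℚ.toℚᵘ-injective (begin
    ℚ.toℚᵘ (ι (a ℕ.+ b))               ≈⟨ toℚᵘ-/ (ℤ.+ (a ℕ.+ b)) 0 ⟩
    ℚᵘ.mkℚᵘ (ℤ.+ (a ℕ.+ b)) 0            ≈⟨ ℚᵘ.*≡* (trans (cong (ℤ._* ℤ.+ 1) (ℤ.pos-+ a b))
         (solve 2 (λ x y → (x :+ y) :* con (ℤ.+ 1)
                := (x :* con (ℤ.+ 1) :+ y :* con (ℤ.+ 1)) :* con (ℤ.+ 1)) refl (ℤ.+ a) (ℤ.+ b))) ⟩
    ℚᵘ.mkℚᵘ (ℤ.+ a) 0 ℚᵘ.+ ℚᵘ.mkℚᵘ (ℤ.+ b) 0  ≈⟨ ℚᵘ.+-cong (toℚᵘ-/ (ℤ.+ a) 0) (toℚᵘ-/ (ℤ.+ b) 0) ⟨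
    ℚ.toℚᵘ (ι a) ℚᵘ.+ ℚ.toℚᵘ (ι b)     ≈⟨ ℚ.toℚᵘ-homo-+ (ι a) (ι b) ⟨
    ℚ.toℚᵘ (ι a + ι b)                 ∎)
    where
    open ℚᵘ.≃-Reasoning
    open ℤSolver.+-*-Solver

  /-*-ι : ∀ a b d → (ℤ.+ a ℚ./ suc d) * ι b ≡ ℤ.+ (a ℕ.* b) ℚ./ suc d
  /-*-ι a b d = ℚ.toℚᵘ-injective (begin
    ℚ.toℚᵘ ((ℤ.+ a ℚ./ suc d) * ι b)      ≈⟨ ℚ.toℚᵘ-homo-* (ℤ.+ a ℚ./ suc d) (ι b) ⟩
    ℚ.toℚᵘ (ℤ.+ a ℚ./ suc d) ℚᵘ.* ℚ.toℚᵘ (ι b)  ≈⟨ ℚᵘ.*-cong (toℚᵘ-/ (ℤ.+ a) d) (toℚᵘ-/ (ℤ.+ b) 0) ⟩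
    ℚᵘ.mkℚᵘ (ℤ.+ a) d ℚᵘ.* ℚᵘ.mkℚᵘ (ℤ.+ b) 0  ≈⟨ ℚᵘ.*≡* (trans
          (solve 3 (λ x y z → (x :* y) :* z := (x :* y) :* (z :* con (ℤ.+ 1))) refl (ℤ.+ a) (ℤ.+ b) (ℤ.+ suc d))
          (cong (ℤ._* (ℤ.+ suc d ℤ.* ℤ.+ 1)) (sym (ℤ.pos-* a b)))) ⟩
    ℚᵘ.mkℚᵘ (ℤ.+ (a ℕ.* b)) d            ≈⟨ toℚᵘ-/ (ℤ.+ (a ℕ.* b)) d ⟨
    ℚ.toℚᵘ (ℤ.+ (a ℕ.* b) ℚ./ suc d)     ∎)
    where
    open ℚᵘ.≃-Reasoning
    open ℤSolver.+-*-Solver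

  ι-* : ∀ a b → ι (a ℕ.* b) ≡ ι a * ι b
  ι-* a b = sym (/-*-ι a b 0)

ι-suc : ∀ a → ι (suc a) ≡ 1ℚ + ι a
ι-suc a = trans (ι-+ 1 a) (cong (_+ ι a) ι-1)

0≤ι : ∀ a → 0ℚ ≤ ι a
0≤ι a = subst (_≤ ι a) ι-0 (ι-mono-≤ ℕ.z≤n)

∣ι∣ : ∀ a → ∣ ι a ∣ ≡ ι a
∣ι∣ a = ℚ.0≤p⇒∣p∣≡p (0≤ι a)

/-cancel : ∀ a d → (ℤ.+ a ℚ./ suc d) * ι (suc d) ≡ ι a
/-cancel a d = trans (/-*-ι a (suc d) d) (trans (ℚ.≤-antisym
  (/-mono-≤ (a ℕ.* suc d) a d 0 (ℕ.≤-reflexive (ℕ.*-identityʳ (a ℕ.* suc d))))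
  (/-mono-≤ a (a ℕ.* suc d) 0 d (ℕ.≤-reflexive (sym (ℕ.*-identityʳ (a ℕ.* suc d)))))) (sym (ι-def a)))

∣^∣ : ∀ x m → ∣ x ^ m ∣ ≡ ∣ x ∣ ^ m
∣^∣ x zero    = refl
∣^∣ x (suc m) = trans (ℚ.∣p*q∣≡∣p∣*∣q∣ x (x ^ m)) (cong (∣ x ∣ *_) (∣^∣ x m))

0≤^ : ∀ {x} → 0ℚ ≤ x → ∀ m → 0ℚ ≤ x ^ m
0≤^ 0≤x zero    = ℚ.nonNegative⁻¹ 1ℚ
0≤^ {x} 0≤x (suc m) = subst (_≤ x * x ^ m) (ℚ.*-zeroʳ x)
  (ℚ.*-monoˡ-≤-nonNeg x {{ℚ.nonNegative 0≤x}} (0≤^ 0≤x m))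

^-mono-≤ : ∀ {x y} → 0ℚ ≤ x → x ≤ y → ∀ m → x ^ m ≤ y ^ m
^-mono-≤ 0≤x x≤y zero    = ℚ.≤-refl
^-mono-≤ {x} {y} 0≤x x≤y (suc m) = ℚ.≤-trans
  (ℚ.*-monoˡ-≤-nonNeg x {{ℚ.nonNegative 0≤x}} (^-mono-≤ 0≤x x≤y m))
  (ℚ.*-monoʳ-≤-nonNeg (y ^ m) {{ℚ.nonNegative (0≤^ (ℚ.≤-trans 0≤x x≤y) m)}} x≤y)

^-antimono-≤ : ∀ {x} → 0ℚ ≤ x → x ≤ 1ℚ → ∀ {a b} → a ℕ.≤ b → x ^ b ≤ x ^ a
^-antimono-≤ 0≤x x≤1 {b = zero}  ℕ.z≤n = ℚ.≤-refl
^-antimono-≤ {x} 0≤x x≤1 {b = suc b} ℕ.z≤n = ℚ.≤-trans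
  (ℚ.*-monoˡ-≤-nonNeg x {{ℚ.nonNegative 0≤x}} (^-antimono-≤ 0≤x x≤1 {b = b} ℕ.z≤n))
  (subst (_≤ 1ℚ) (sym (ℚ.*-identityʳ x)) x≤1)
^-antimono-≤ {x} 0≤x x≤1 (ℕ.s≤s a≤b) = ℚ.*-monoˡ-≤-nonNeg x {{ℚ.nonNegative 0≤x}} (^-antimono-≤ 0≤x x≤1 a≤b)

------------------------------------------------------------------------
-- Indicators and the enumeration of Boolean functions

-- The indicator of a decidable proposition.
𝟙 : {P : Set} → Dec P → ℚ
𝟙 d = if does d then 1ℚ else 0ℚ

𝟙-yes : {P : Set} (d : Dec P) → P → 𝟙 d ≡ 1ℚ
𝟙-yes (yes _) p = refl
𝟙-yes (no ¬p) p = contradiction p ¬p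

𝟙-no : {P : Set} (d : Dec P) → ¬ P → 𝟙 d ≡ 0ℚ
𝟙-no (yes p) ¬p = contradiction p ¬p
𝟙-no (no _)  _  = refl

𝟙-cong : {P Q : Set} (d : Dec P) (e : Dec Q) → (P → Q) → (Q → P) → 𝟙 d ≡ 𝟙 e
𝟙-cong d (yes q) to from = 𝟙-yes d (from q)
𝟙-cong d (no ¬q) to from = 𝟙-no d (¬q ∘ to)

∑-filter : ∀ {P : A → Set} (P? : ∀ x → Dec (P x)) xs F →
  ∑ (filter P? xs) F ≡ ∑ xs (λ x → 𝟙 (P? x) * F x)
∑-filter P? []       F = refl
∑-filter P? (x ∷ xs) F with P? x
... | yes _ = cong₂ _+_ (sym (ℚ.*-identityˡ (F x))) (∑-filter P? xs F)
... | no _  = trans (∑-filter P? xs F) (sym (trans (cong (_+ _) (ℚ.*-zeroˡ (F x))) (ℚ.+-identityˡ _)))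

-- A map on Boolean functions that respects pointwise equality.
Extensional : (BoolFun n → A) → Set
Extensional F = ∀ f g → f ≗ g → F f ≡ F g

if-∧ : ∀ a b → (if a ∧ b then 1ℚ else 0ℚ) ≡ (if a then 1ℚ else 0ℚ) * (if b then 1ℚ else 0ℚ)
if-∧ false b = sym (ℚ.*-zeroˡ (if b then 1ℚ else 0ℚ))
if-∧ true  b = sym (ℚ.*-identityˡ (if b then 1ℚ else 0ℚ))

-- Every Boolean function occurs exactly once, up to pointwise equality, in the
-- enumeration; hence summing against the indicator of g evaluates at g.
∑-point : (F : BoolFun n → ℚ) → Extensional F → ∀ g → ∑ (allBoolFuns n) (λ f → 𝟙 (g ≗? f) * F f) ≡ F g
∑-point {zero} F ext g with g [] in e
... | false = trans
  (cong₂ (λ x y → x + (y + 0ℚ)) (ℚ.*-identityˡ (F (const false))) (ℚ.*-zeroˡ (F (const true))))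
  (trans (ℚ.+-identityʳ (F (const false))) (ext _ _ λ { [] → sym e }))
... | true = trans
  (cong₂ (λ x y → x + (y + 0ℚ)) (ℚ.*-zeroˡ (F (const false))) (ℚ.*-identityˡ (F (const true))))
  (trans (ℚ.+-identityˡ (F (const true) + 0ℚ)) (trans (ℚ.+-identityʳ (F (const true))) (ext _ _ λ { [] → sym e })))
∑-point {suc n} F ext g = begin
  ∑ (allBoolFuns (suc n)) (λ f → 𝟙 (g ≗? f) * F f)
    ≡⟨ ∑-product _ (allBoolFuns n) (allBoolFuns n) (λ f → 𝟙 (g ≗? f) * F f) ⟩
  -- The summation index is the glued function of the enumeration, which is only
  -- pointwise equal to glue f₀ f₁.
  _
    ≡⟨ ∑-cong (allBoolFuns n) (λ f₀ → ∑-cong (allBoolFuns n) (λ f₁ → cong₂ _*_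
         (if-∧ (does (g₀ ≗? f₀)) (does (g₁ ≗? f₁))) (ext _ (glue f₀ f₁) (λ { (false ∷ x) → refl ; (true ∷ x) → refl })))) ⟩
  ∑ (allBoolFuns n) (λ f₀ → ∑ (allBoolFuns n) (λ f₁ → (𝟙 (g₀ ≗? f₀) * 𝟙 (g₁ ≗? f₁)) * F (glue f₀ f₁)))
    ≡⟨ ∑-cong (allBoolFuns n) (λ f₀ → trans
         (∑-cong (allBoolFuns n) (λ f₁ → ℚ.*-assoc (𝟙 (g₀ ≗? f₀)) (𝟙 (g₁ ≗? f₁)) _))
         (∑-*ˡ (allBoolFuns n) (𝟙 (g₀ ≗? f₀)) _)) ⟩
  ∑ (allBoolFuns n) (λ f₀ → 𝟙 (g₀ ≗? f₀) * ∑ (allBoolFuns n) (λ f₁ → 𝟙 (g₁ ≗? f₁) * F (glue f₀ f₁)))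
    ≡⟨ ∑-cong (allBoolFuns n) (λ f₀ → cong (𝟙 (g₀ ≗? f₀) *_)
         (∑-point (λ f₁ → F (glue f₀ f₁)) (λ f h e → ext _ _ (λ { (false ∷ x) → refl ; (true ∷ x) → e x })) g₁)) ⟩
  ∑ (allBoolFuns n) (λ f₀ → 𝟙 (g₀ ≗? f₀) * F (glue f₀ g₁))
    ≡⟨ ∑-point (λ f₀ → F (glue f₀ g₁)) (λ f h e → ext _ _ (λ { (false ∷ x) → e x ; (true ∷ x) → refl })) g₀ ⟩
  F (glue g₀ g₁)
    ≡⟨ ext _ _ (λ { (false ∷ x) → refl ; (true ∷ x) → refl }) ⟩
  F g ∎
  where
  open ≡-Reasoning
  g₀ g₁ : BoolFun n
  g₀ = g ∘ (false ∷_)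
  g₁ = g ∘ (true ∷_)
  glue : BoolFun n → BoolFun n → BoolFun (suc n)
  glue f₀ f₁ (b ∷ x) = if b then f₁ x else f₀ x

------------------------------------------------------------------------
-- Expectations and one step of the growth process

-- The expectation of F(g) for a random function g with distribution p.
𝔼 : Dist n → (BoolFun n → ℚ) → ℚ
𝔼 {n} p F = ∑ (allBoolFuns n) (λ g → p g * F g)

grow-∑ : ∀ (α : BoolFun k) (p : Dist n) f →
  grow α p f ≡ ∑ (tuples (allBoolFuns n) k) (λ gs → 𝟙 (compose α gs ≗? f) * jointProb p gs)
grow-∑ {k} {n} α p f = ∑-filter (λ gs → compose α gs ≗? f) (tuples (allBoolFuns n) k) (jointProb p)

-- The expectation after one growth step is the expectation of F(α(g₁,...,g_k))
-- over independent g₁,...,g_k.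
𝔼-grow : ∀ (α : BoolFun k) (p : Dist n) F → Extensional F →
  𝔼 (grow α p) F ≡ ∑ (tuples (allBoolFuns n) k) (λ gs → jointProb p gs * F (compose α gs))
𝔼-grow {k} {n} α p F ext = begin
  ∑ fs (λ f → grow α p f * F f)
    ≡⟨ ∑-cong fs (λ f → trans (cong (_* F f) (grow-∑ α p f)) (sym (∑-*ʳ gss (F f) _))) ⟩
  ∑ fs (λ f → ∑ gss (λ gs → (𝟙 (compose α gs ≗? f) * jointProb p gs) * F f))
    ≡⟨ ∑-swap fs gss _ ⟩
  ∑ gss (λ gs → ∑ fs (λ f → (𝟙 (compose α gs ≗? f) * jointProb p gs) * F f))
    ≡⟨ ∑-cong gss (λ gs → trans
         (∑-cong fs (λ f → solve 3 (λ a b c → (a :* b) :* c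
                := b :* (a :* c)) refl (𝟙 (compose α gs ≗? f)) (jointProb p gs) (F f)))
         (trans (∑-*ˡ fs (jointProb p gs) _) (cong (jointProb p gs *_) (∑-point F ext (compose α gs))))) ⟩
  ∑ gss (λ gs → jointProb p gs * F (compose α gs)) ∎
  where
  open ≡-Reasoning
  open +-*-Solver
  fs = allBoolFuns n
  gss = tuples fs k

-- A sum of products over all k-tuples factorises.  Here q is an arbitrary
-- weight, for which jointProb is the product of the weights of the entries.
∑-tuples : ∀ (xs : List (BoolFun n)) (q : BoolFun n → ℚ) k → ∑ (tuples xs k) (jointProb q) ≡ ∑ xs q ^ k
∑-tuples xs q zero    = refl
∑-tuples xs q (suc k) = begin
  ∑ (tuples xs (suc k)) (jointProb q)
    ≡⟨ ∑-product _∷_ xs (tuples xs k) (jointProb q) ⟩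
  ∑ xs (λ x → ∑ (tuples xs k) (λ gs → q x * jointProb q gs))
    ≡⟨ ∑-cong xs (λ x → ∑-*ˡ (tuples xs k) (q x) (jointProb q)) ⟩
  ∑ xs (λ x → q x * ∑ (tuples xs k) (jointProb q))
    ≡⟨ ∑-*ʳ xs (∑ (tuples xs k) (jointProb q)) q ⟩
  ∑ xs q * ∑ (tuples xs k) (jointProb q)
    ≡⟨ cong (∑ xs q *_) (∑-tuples xs q k) ⟩
  ∑ xs q * ∑ xs q ^ k ∎
  where
  open ≡-Reasoning

jointProb-* : ∀ (p q : Dist n) (gs : Vec (BoolFun n) k) →
  jointProb p gs * jointProb q gs ≡ jointProb (λ g → p g * q g) gs
jointProb-* p q []       = refl
jointProb-* p q (g ∷ gs) = trans
  (solve 4 (λ a b c d → (a :* b) :* (c :* d)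
         := (a :* c) :* (b :* d)) refl (p g) (jointProb p gs) (q g) (jointProb q gs))
  (cong (p g * q g *_) (jointProb-* p q gs))
  where
  open +-*-Solver

------------------------------------------------------------------------
-- Characters of the additive group of Boolean functions

-- The sign (-1)^b.
sign : Bool → ℚ
sign false = 1ℚ
sign true  = - 1ℚ

sign-xor : ∀ a b → sign (a xor b) ≡ sign a * sign b
sign-xor false b     = sym (ℚ.*-identityˡ (sign b))
sign-xor true  false = refl
sign-xor true  true  = refl

∣sign∣ : ∀ b → ∣ sign b ∣ ≡ 1ℚ
∣sign∣ false = refl
∣sign∣ true  = refl

-- The scalar product over GF(2).
dot : Vec Bool n → Vec Bool n → Bool
dot c x = ⨁ (zipWith _∧_ c x)

-- The additive functional g ↦ t g(0) + g(0) + g(x) over GF(2) attached to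
-- (t , x).  On the linear function c₀ ⊕ c·y it takes the value c₀ t + c·x,
-- so (t , x) is the frequency dual to the coefficient vector (c₀ , c).
exponent : Vec Bool (suc n) → BoolFun n → Bool
exponent {n} (t ∷ s) g = (t ∧ g 0⃗) xor (g 0⃗ xor g s)
  where 0⃗ = replicate n false

-- The character attached to a frequency.
χ : Vec Bool (suc n) → BoolFun n → ℚ
χ s g = sign (exponent s g)

-- Pointwise addition over GF(2).
_⊕_ : BoolFun n → BoolFun n → BoolFun n
(f ⊕ g) x = f x xor g x

χ-extensional : ∀ (s : Vec Bool (suc n)) → Extensional (χ s)
χ-extensional (t ∷ s) f g e = cong sign (cong₂ (λ a b → (t ∧ a) xor (a xor b)) (e _) (e s))

χ-⊕ : ∀ (s : Vec Bool (suc n)) f g → χ s (f ⊕ g) ≡ χ s f * χ s g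
χ-⊕ {n} (t ∷ s) f g = trans
  (cong sign (solve 5 (λ t a b c d → (t :* (a :+ b)) :+ ((a :+ b) :+ (c :+ d)) :=
      ((t :* a) :+ (a :+ c)) :+ ((t :* b) :+ (b :+ d))) refl t (f 0⃗) (g 0⃗) (f s) (g s)))
  (sign-xor (exponent (t ∷ s) f) (exponent (t ∷ s) g))
  where
  open BoolSolver.xor-∧-Solver
  0⃗ = replicate n false

compose-∷ : ∀ c g (gs : Vec (BoolFun n) k) →
  compose (linearConnective c) (g ∷ gs) ≗ g ⊕ compose (linearConnective c) gs
compose-∷ c g gs x = solve 3 (λ c a b → c :+ (a :+ b)
       := a :+ (c :+ b)) refl c (g x) (⨁ (Vec.map (λ h → h x) gs))
  where
  open BoolSolver.xor-∧-Solver

χ-compose : ∀ (s : Vec Bool (suc n)) c (gs : Vec (BoolFun n) k) →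
  χ s (compose (linearConnective c) gs) ≡ χ s (const c) * jointProb (χ s) gs
χ-compose s c []       = trans (χ-extensional s _ _ (λ _ → Bool.xor-identityʳ c)) (sym (ℚ.*-identityʳ (χ s (const c))))
χ-compose s c (g ∷ gs) = begin
  χ s (compose (linearConnective c) (g ∷ gs))
    ≡⟨ χ-extensional s _ _ (compose-∷ c g gs) ⟩
  χ s (g ⊕ compose (linearConnective c) gs)
    ≡⟨ χ-⊕ s g (compose (linearConnective c) gs) ⟩
  χ s g * χ s (compose (linearConnective c) gs)
    ≡⟨ cong (χ s g *_) (χ-compose s c gs) ⟩
  χ s g * (χ s (const c) * jointProb (χ s) gs)
    ≡⟨ solve 3 (λ x y z → x :* (y :* z) := y :* (x :* z)) refl (χ s g) (χ s (const c)) (jointProb (χ s) gs) ⟩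
  χ s (const c) * (χ s g * jointProb (χ s) gs) ∎
  where
  open ≡-Reasoning
  open +-*-Solver

-- Addition of independent functions multiplies Fourier coefficients.
𝔼-χ-grow : ∀ c (p : Dist n) s → 𝔼 (grow {k} (linearConnective c) p) (χ s) ≡ χ s (const c) * 𝔼 p (χ s) ^ k
𝔼-χ-grow {n} {k} c p s = begin
  𝔼 (grow (linearConnective {k} c) p) (χ s)
    ≡⟨ 𝔼-grow (linearConnective {k} c) p (χ s) (χ-extensional s) ⟩
  ∑ gss (λ gs → jointProb p gs * χ s (compose (linearConnective c) gs))
    ≡⟨ ∑-cong gss (λ gs → trans (cong (jointProb p gs *_) (χ-compose s c gs))
         (trans (solve 3 (λ x y z → x :* (y :* z)
                := y :* (x :* z)) refl (jointProb p gs) (χ s (const c)) (jointProb (χ s) gs))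
           (cong (χ s (const c) *_) (jointProb-* p (χ s) gs)))) ⟩
  ∑ gss (λ gs → χ s (const c) * jointProb (λ g → p g * χ s g) gs)
    ≡⟨ ∑-*ˡ gss (χ s (const c)) _ ⟩
  χ s (const c) * ∑ gss (jointProb (λ g → p g * χ s g))
    ≡⟨ cong (χ s (const c) *_) (∑-tuples (allBoolFuns n) (λ g → p g * χ s g) k) ⟩
  χ s (const c) * 𝔼 p (χ s) ^ k ∎
  where
  open ≡-Reasoning
  open +-*-Solver
  gss = tuples (allBoolFuns n) k

------------------------------------------------------------------------
-- Linear functions

dot-0ʳ : (c : Vec Bool n) → dot c (replicate n false) ≡ false
dot-0ʳ []          = refl
dot-0ʳ (false ∷ c) = dot-0ʳ c
dot-0ʳ (true ∷ c)  = dot-0ʳ c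

dot-0ˡ : (x : Vec Bool n) → dot (replicate n false) x ≡ false
dot-0ˡ []      = refl
dot-0ˡ (b ∷ x) = dot-0ˡ x

dot-⊕ : (c d x : Vec Bool n) → dot (zipWith _xor_ c d) x ≡ dot c x xor dot d x
dot-⊕ []      []      []      = refl
dot-⊕ (a ∷ c) (b ∷ d) (y ∷ x) = trans (cong (((a xor b) ∧ y) xor_) (dot-⊕ c d x))
  (solve 5 (λ a b y p q → ((a :+ b) :* y) :+ (p :+ q)
         := ((a :* y) :+ p) :+ ((b :* y) :+ q)) refl a b y (dot c x) (dot d x))
  where
  open BoolSolver.xor-∧-Solver

dot-unit : ∀ (j : Fin n) x → dot (replicate n false [ j ]≔ true) x ≡ lookup x j
dot-unit zero    (b ∷ x) = trans (cong (b xor_) (dot-0ˡ x)) (Bool.xor-identityʳ b)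
dot-unit (suc j) (b ∷ x) = dot-unit j x

linear-resp : {f g : BoolFun n} → f ≗ g → IsLinear f → IsLinear g
linear-resp e (c₀ , c , h) = c₀ , c , λ x → trans (sym (e x)) (h x)

linear-const : ∀ b → IsLinear {n} (const b)
linear-const b = b , replicate _ false , λ x → sym (trans (cong (b xor_) (dot-0ˡ x)) (Bool.xor-identityʳ b))

linear-⊕ : {f g : BoolFun n} → IsLinear f → IsLinear g → IsLinear (f ⊕ g)
linear-⊕ (c₀ , c , h) (d₀ , d , h′) = c₀ xor d₀ , zipWith _xor_ c d , λ x → trans (cong₂ _xor_ (h x) (h′ x))
  (trans (solve 4 (λ a b c d → (a :+ b) :+ (c :+ d) := (a :+ c) :+ (b :+ d)) refl c₀ (dot c x) d₀ (dot d x))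
    (cong ((c₀ xor d₀) xor_) (sym (dot-⊕ c d x))))
  where
  open BoolSolver.xor-∧-Solver

linear-compose : ∀ c {gs : Vec (BoolFun n) k} → VecAll.All IsLinear gs → IsLinear (compose (linearConnective c) gs)
linear-compose c []                = linear-resp {f = const c} (λ _ → sym (Bool.xor-identityʳ c)) (linear-const c)
linear-compose c {g ∷ gs} (l ∷ ls) =
  linear-resp {f = g ⊕ compose (linearConnective c) gs} (λ x → sym (compose-∷ c g gs x)) (linear-⊕ l (linear-compose c ls))

projections-linear : ∀ n → All IsLinear (projections n)
projections-linear n = All.map⁺ (All.tabulate⁺ {f = λ j → j} λ j → false , replicate n false [ j ]≔ true , λ x → sym (dot-unit j x))

elements-linear : ∀ S n → All IsLinear (elements S n)
elements-linear S n = All.++⁺ (projections-linear n) (All.++⁺ (negs negations?) (All.++⁺ (cst const0? false) (cst const1? true)))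
  where
  open InitialSet S
  negs : ∀ b → All IsLinear (if b then List.map (not ∘_) (projections n) else [])
  negs false = []
  negs true  = All.map⁺ (All.map (λ {g} → linear-⊕ {f = const true} {g} (linear-const true)) (projections-linear n))
  cst : ∀ b v → All (IsLinear {n}) (if b then const v ∷ [] else [])
  cst false v = []
  cst true  v = linear-const v ∷ []

------------------------------------------------------------------------
-- Extensionality and support of the distributions

-- Only linear functions have nonzero probability.
LinearSupport : Dist n → Set
LinearSupport p = ∀ g → p g ≢ 0ℚ → IsLinear g

-- The probability of each element of the initial set.
weight : InitialSet → ∀ n → .{{NonZero n}} → ℚ
weight S n = (ℤ.+ 1 ℚ./ List.length (elements S n)) {{elements-nonEmpty S n}}

if-𝟙 : {P : Set} (d : Dec P) (q : ℚ) → (if does d then q else 0ℚ) ≡ 𝟙 d * q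
if-𝟙 (yes _) q = sym (ℚ.*-identityˡ q)
if-𝟙 (no _)  q = sym (ℚ.*-zeroˡ q)

μ-𝟙 : ∀ S .{{_ : NonZero n}} g → μ S {n} g ≡ 𝟙 (any? (g ≗?_) (elements S n)) * weight S n
μ-𝟙 {n} S g = if-𝟙 (any? (g ≗?_) (elements S n)) (weight S n)

*≢0 : ∀ p q → p * q ≢ 0ℚ → p ≢ 0ℚ × q ≢ 0ℚ
*≢0 p q h = (λ e → h (trans (cong (_* q) e) (ℚ.*-zeroˡ q))) , (λ e → h (trans (cong (p *_) e) (ℚ.*-zeroʳ p)))

μ-support : ∀ S .{{_ : NonZero n}} → LinearSupport (μ S {n})
μ-support {n} S g μg≢0 = from-dec (any? (g ≗?_) (elements S n))
  (proj₁ (*≢0 (𝟙 (any? (g ≗?_) (elements S n))) (weight S n) (μg≢0 ∘ trans (μ-𝟙 S g))))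
  where
  from-dec : ∀ d → 𝟙 d ≢ 0ℚ → IsLinear g
  from-dec (no _)  h = contradiction refl h
  from-dec (yes a) _ = All.lookupWith (λ l e → linear-resp (λ x → sym (e x)) l) (elements-linear S n) a

jointProb-support : {p : Dist n} → LinearSupport p → (gs : Vec (BoolFun n) k) → jointProb p gs ≢ 0ℚ → VecAll.All IsLinear gs
jointProb-support         supp []       h = []
jointProb-support {p = p} supp (g ∷ gs) h =
  supp g (proj₁ (*≢0 (p g) (jointProb p gs) h)) ∷ jointProb-support supp gs (proj₂ (*≢0 (p g) (jointProb p gs) h))

grow-support : ∀ c {p : Dist n} → LinearSupport p → LinearSupport (grow {k} (linearConnective c) p)
grow-support {n} {k} c {p} supp f h
  with gs , h′ ← ∑≢0⇒∃ (tuples (allBoolFuns n) k) _ (h ∘ trans (grow-∑ (linearConnective {k} c) p f))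
  with *≢0 (𝟙 (compose (linearConnective c) gs ≗? f)) (jointProb p gs) h′
... | h₁ , h₂ with compose (linearConnective c) gs ≗? f
... | yes e = linear-resp e (linear-compose c (jointProb-support supp gs h₂))
... | no _  = contradiction refl h₁

growth-support : ∀ S c .{{_ : NonZero n}} i → LinearSupport (growth {k} {n} S (linearConnective c) i)
growth-support S c zero    = μ-support S
growth-support {k = k} S c (suc i) = grow-support {k = k} c (growth-support {k = k} S c i)

μ-extensional : ∀ S .{{_ : NonZero n}} → Extensional (μ S {n})
μ-extensional {n} S f g e = trans (μ-𝟙 S f) (trans (cong (_* weight S n)
  (𝟙-cong (any? (f ≗?_) (elements S n)) (any? (g ≗?_) (elements S n))
    (Any.map (λ e′ x → trans (sym (e x)) (e′ x))) (Any.map (λ e′ x → trans (e x) (e′ x)))))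
  (sym (μ-𝟙 S g)))

grow-extensional : ∀ (α : BoolFun k) (p : Dist n) → Extensional (grow α p)
grow-extensional {k} {n} α p f g e = trans (grow-∑ α p f) (trans
  (∑-cong (tuples (allBoolFuns n) k) (λ gs → cong (_* jointProb p gs)
    (𝟙-cong (compose α gs ≗? f) (compose α gs ≗? g) (λ h x → trans (h x) (e x)) (λ h x → trans (h x) (sym (e x))))))
  (sym (grow-∑ α p g)))

growth-extensional : ∀ S (α : BoolFun k) .{{_ : NonZero n}} i → Extensional (growth {k} {n} S α i)
growth-extensional S α zero    = μ-extensional S
growth-extensional S α (suc i) = grow-extensional α (growth S α i)

------------------------------------------------------------------------
-- Orthogonality of characters and Fourier inversion

-- All vectors of GF(2)^n, each once, the zero vector first.
bits : ∀ n → List (Vec Bool n)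
bits = tuples (false ∷ true ∷ [])

∑-bits : ∀ n (F : Vec Bool (suc n) → ℚ) → ∑ (bits (suc n)) F ≡ ∑ (bits n) (F ∘ (false ∷_)) + ∑ (bits n) (F ∘ (true ∷_))
∑-bits n F = trans (∑-product _∷_ (false ∷ true ∷ []) (bits n) F) (cong (λ z → ∑ (bits n) (F ∘ (false ∷_)) + z) (ℚ.+-identityʳ _))

∑-bits-const : ∀ n q → ∑ (bits n) (const q) ≡ ι (2 ℕ.^ n) * q
∑-bits-const zero    q = trans (ℚ.+-identityʳ q) (sym (trans (cong (_* q) ι-1) (ℚ.*-identityˡ q)))
∑-bits-const (suc n) q = trans (∑-bits n (const q)) (trans (cong₂ _+_ (∑-bits-const n q) (∑-bits-const n q))
  (trans (sym (ℚ.*-distribʳ-+ q (ι (2 ℕ.^ n)) (ι (2 ℕ.^ n))))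
    (cong (_* q) (trans (cong (ι (2 ℕ.^ n) +_) (cong ι (sym (ℕ.+-identityʳ (2 ℕ.^ n))))) (sym (ι-+ (2 ℕ.^ n) (2 ℕ.^ n ℕ.+ 0)))))))

-- A linear functional on GF(2)^n is zero or takes both values equally often.
dot-dichotomy : (e : Vec Bool n) → (∀ s → dot e s ≡ false) ⊎ ∑ (bits n) (sign ∘ dot e) ≡ 0ℚ
dot-dichotomy []          = inj₁ λ { [] → refl }
dot-dichotomy {suc n} (false ∷ e) with dot-dichotomy e
... | inj₁ h = inj₁ λ { (_ ∷ s) → h s }
... | inj₂ h = inj₂ (trans (∑-bits n _) (cong₂ _+_ h h))
dot-dichotomy {suc n} (true ∷ e) = inj₂ (begin
  ∑ (bits (suc n)) (sign ∘ dot (true ∷ e))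
    ≡⟨ ∑-bits n _ ⟩
  X + ∑ (bits n) (λ s → sign (true xor dot e s))
    ≡⟨ cong (X +_) (trans (∑-cong (bits n) (λ s → sign-xor true (dot e s))) (∑-*ˡ (bits n) (- 1ℚ) (sign ∘ dot e))) ⟩
  X + - 1ℚ * X
    ≡⟨ solve 1 (λ x → x :+ :- con 1ℚ :* x := con 0ℚ) refl X ⟩
  0ℚ ∎)
  where
  open ≡-Reasoning
  open +-*-Solver
  X = ∑ (bits n) (sign ∘ dot e)

-- Restricted to linear functions, χ s is the standard character of the
-- coefficient vector at frequency s.
χ-linear : ∀ {f : BoolFun n} ((c₀ , c , _) : IsLinear f) s → χ s f ≡ sign (dot (c₀ ∷ c) s)
χ-linear {n} {f} (c₀ , c , h) (t ∷ s) = cong sign (begin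
  (t ∧ f 0⃗) xor (f 0⃗ xor f s)
    ≡⟨ cong₂ (λ a b → (t ∧ a) xor (a xor b)) (trans (h 0⃗) (trans (cong (c₀ xor_) (dot-0ʳ c)) (Bool.xor-identityʳ c₀))) (h s) ⟩
  (t ∧ c₀) xor (c₀ xor (c₀ xor dot c s))
    ≡⟨ solve 3 (λ t a b → (t :* a) :+ (a :+ (a :+ b)) := (a :* t) :+ b) refl t c₀ (dot c s) ⟩
  (c₀ ∧ t) xor dot c s ∎)
  where
  open ≡-Reasoning
  open BoolSolver.xor-∧-Solver
  0⃗ = replicate n false

χ-orthogonal : ∀ {f g : BoolFun n} → IsLinear f → IsLinear g →
  ∑ (bits (suc n)) (λ s → χ s f * χ s g) ≡ 𝟙 (f ≗? g) * ι (2 ℕ.^ suc n)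
χ-orthogonal {n} {f} {g} lf lg = by-cases (f ≗? g)
  where
  open ≡-Reasoning
  l = linear-⊕ {f = f} {g} lf lg
  d₀ = proj₁ l
  d = proj₁ (proj₂ l)
  sign² : ∀ b → sign b * sign b ≡ 1ℚ
  sign² false = refl
  sign² true  = refl
  xor≡false : ∀ a b → a xor b ≡ false → a ≡ b
  xor≡false false false _ = refl
  xor≡false true  true  _ = refl
  agree : (∀ s → dot (d₀ ∷ d) s ≡ false) → f ≗ g
  agree vanishes x = xor≡false (f x) (g x) (trans (proj₂ (proj₂ l) x)
    (trans (cong (_xor dot d x) (sym (Bool.∧-identityʳ d₀))) (vanishes (true ∷ x))))
  by-cases : (e : Dec (f ≗ g)) → ∑ (bits (suc n)) (λ s → χ s f * χ s g) ≡ 𝟙 e * ι (2 ℕ.^ suc n)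
  by-cases (yes f≗g) = begin
    ∑ (bits (suc n)) (λ s → χ s f * χ s g)
      ≡⟨ ∑-cong (bits (suc n)) (λ s → trans (cong (χ s f *_) (sym (χ-extensional s f g f≗g))) (sign² (exponent s f))) ⟩
    ∑ (bits (suc n)) (const 1ℚ)             ≡⟨ ∑-bits-const (suc n) 1ℚ ⟩
    ι (2 ℕ.^ suc n) * 1ℚ                    ≡⟨ ℚ.*-comm (ι (2 ℕ.^ suc n)) 1ℚ ⟩
    1ℚ * ι (2 ℕ.^ suc n)                    ∎
  by-cases (no f≗̸g) = begin
    ∑ (bits (suc n)) (λ s → χ s f * χ s g)
      ≡⟨ ∑-cong (bits (suc n)) (λ s → trans (sym (χ-⊕ s f g)) (χ-linear {f = f ⊕ g} l s)) ⟩
    ∑ (bits (suc n)) (sign ∘ dot (d₀ ∷ d))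
      ≡⟨ [ (λ vanishes → contradiction (agree vanishes) f≗̸g) , id ]′ (dot-dichotomy (d₀ ∷ d)) ⟩
    0ℚ                                      ≡⟨ ℚ.*-zeroˡ (ι (2 ℕ.^ suc n)) ⟨
    0ℚ * ι (2 ℕ.^ suc n)                    ∎

-- Fourier inversion.  As p vanishes off the linear functions, the sum over g
-- of p g · χ s g only involves functions to which orthogonality applies.
inversion : ∀ {p : Dist n} → Extensional p → LinearSupport p → ∀ {f} → IsLinear f →
  ∑ (bits (suc n)) (λ s → χ s f * 𝔼 p (χ s)) ≡ ι (2 ℕ.^ suc n) * p f
inversion {n} {p} ext supp {f} lf = begin
  ∑ ss (λ s → χ s f * ∑ gs (λ g → p g * χ s g))
    ≡⟨ ∑-cong ss (λ s → sym (∑-*ˡ gs (χ s f) _)) ⟩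
  ∑ ss (λ s → ∑ gs (λ g → χ s f * (p g * χ s g)))
    ≡⟨ ∑-swap ss gs _ ⟩
  ∑ gs (λ g → ∑ ss (λ s → χ s f * (p g * χ s g)))
    ≡⟨ ∑-cong gs (λ g → trans
         (∑-cong ss (λ s → solve 3 (λ x y z → x :* (y :* z) := y :* (x :* z)) refl (χ s f) (p g) (χ s g)))
         (∑-*ˡ ss (p g) _)) ⟩
  ∑ gs (λ g → p g * ∑ ss (λ s → χ s f * χ s g))
    ≡⟨ ∑-cong gs collapse ⟩
  ∑ gs (λ g → ι (2 ℕ.^ suc n) * (𝟙 (f ≗? g) * p g))
    ≡⟨ ∑-*ˡ gs (ι (2 ℕ.^ suc n)) _ ⟩
  ι (2 ℕ.^ suc n) * ∑ gs (λ g → 𝟙 (f ≗? g) * p g)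
    ≡⟨ cong (ι (2 ℕ.^ suc n) *_) (∑-point p ext f) ⟩
  ι (2 ℕ.^ suc n) * p f ∎
  where
  open ≡-Reasoning
  open +-*-Solver
  ss = bits (suc n)
  gs = allBoolFuns n
  collapse : ∀ g → p g * ∑ ss (λ s → χ s f * χ s g) ≡ ι (2 ℕ.^ suc n) * (𝟙 (f ≗? g) * p g)
  collapse g with p g ℚ.≟ 0ℚ
  ... | yes e = trans (cong (_* ∑ ss (λ s → χ s f * χ s g)) e) (trans (ℚ.*-zeroˡ (∑ ss (λ s → χ s f * χ s g))) (sym (trans (cong (λ z → ι (2 ℕ.^ suc n) * (𝟙 (f ≗? g) * z)) e)
    (solve 2 (λ x y → x :* (y :* con 0ℚ) := con 0ℚ) refl (ι (2 ℕ.^ suc n)) (𝟙 (f ≗? g))))))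
  ... | no ne = trans (cong (p g *_) (χ-orthogonal lf (supp g ne)))
    (solve 3 (λ x y z → x :* (y :* z) := z :* (y :* x)) refl (p g) (𝟙 (f ≗? g)) (ι (2 ℕ.^ suc n)))

------------------------------------------------------------------------
-- The Fourier transform of the initial distribution

-- For a list without repetitions, membership is counted by a sum.
𝟙-any : ∀ {xs} → AllPairs (λ f g → ¬ f ≗ g) xs → (f : BoolFun n) →
  𝟙 (any? (f ≗?_) xs) ≡ ∑ xs (λ g → 𝟙 (f ≗? g))
𝟙-any []                        f = refl
𝟙-any {n} {x ∷ xs} (x∉xs ∷ distinct) f = by-cases (f ≗? x)
  where
  absent : ∀ {ys} → f ≗ x → All (λ g → ¬ x ≗ g) ys → ∑ ys (λ g → 𝟙 (f ≗? g)) ≡ 0ℚ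
  absent e []                = refl
  absent e (_∷_ {y} {ys} x≗̸y h) = cong₂ _+_ (𝟙-no (f ≗? y) (λ e′ → x≗̸y (λ z → trans (sym (e z)) (e′ z)))) (absent e h)
  by-cases : Dec (f ≗ x) → 𝟙 (any? (f ≗?_) (x ∷ xs)) ≡ 𝟙 (f ≗? x) + ∑ xs (λ g → 𝟙 (f ≗? g))
  by-cases (yes e) = trans (𝟙-yes (any? (f ≗?_) (x ∷ xs)) (here e))
    (sym (cong₂ _+_ (𝟙-yes (f ≗? x) e) (absent e x∉xs)))
  by-cases (no ne) = begin
    𝟙 (any? (f ≗?_) (x ∷ xs))  ≡⟨ 𝟙-cong (any? (f ≗?_) (x ∷ xs)) (any? (f ≗?_) xs) (Any.tail ne) there ⟩
    𝟙 (any? (f ≗?_) xs)        ≡⟨ 𝟙-any distinct f ⟩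
    X                          ≡⟨ ℚ.+-identityˡ X ⟨
    0ℚ + X                     ≡⟨ cong (_+ X) (𝟙-no (f ≗? x) ne) ⟨
    𝟙 (f ≗? x) + X             ∎
    where
    open ≡-Reasoning
    X = ∑ xs (λ g → 𝟙 (f ≗? g))

-- The values at the all-false and the all-true input.  They tell apart the
-- four kinds of initial functions: projections, negated projections and the two
-- constants.
corners : BoolFun n → Bool × Bool
corners {n} g = g (replicate n false) , g (replicate n true)

separated : ∀ {a b} {xs ys : List (BoolFun n)} → a ≢ b →
  All (λ g → corners g ≡ a) xs → All (λ g → corners g ≡ b) ys → All (λ f → All (λ g → ¬ f ≗ g) ys) xs
separated a≢b hx hy = All.map (λ f≡a → All.map (λ g≡b e →
  a≢b (trans (sym f≡a) (trans (cong₂ _,_ (e _) (e _)) g≡b))) hy) hx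

projections-distinct : ∀ n → AllPairs (λ f g → ¬ f ≗ g) (projections n)
projections-distinct n = AllPairs.map⁺ (AllPairs.tabulate⁺ {f = id} differ)
  where
  differ : {i j : Fin n} → i ≢ j → ¬ (λ x → lookup x i) ≗ (λ x → lookup x j)
  differ {i} {j} i≢j e with () ← trans (sym (Vec.lookup∘update i (replicate n false) true))
    (trans (e (replicate n false [ i ]≔ true)) (trans (Vec.lookup∘update′ (i≢j ∘ sym) (replicate n false) true)
      (Vec.lookup-replicate j false)))

-- The elements of the initial set are the blocks of projections, negated
-- projections and constants; the lists `negated` and `constant` are the optional
-- blocks, as functions of the flag that switches them on.
module _ (S : InitialSet) (n : ℕ) where
  open InitialSet S

  negated : Bool → List (BoolFun n)
  negated b = if b then List.map (not ∘_) (projections n) else []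

  constant : Bool → Bool → List (BoolFun n)
  constant v b = if b then const v ∷ [] else []

  elements-distinct : AllPairs (λ f g → ¬ f ≗ g) (elements S n)
  elements-distinct =
    AllPairs.++⁺ (projections-distinct n)
      (AllPairs.++⁺ (negated-distinct negations?)
        (AllPairs.++⁺ (constant-distinct false const0?) (constant-distinct true const1?)
          (separated (λ ()) (constant-corners false const0?) (constant-corners true const1?)))
        (++-separated (negated-corners negations?) (λ ()) (constant-corners false const0?)
          (λ ()) (constant-corners true const1?)))
      (All.zipWith (λ (h , h′) → All.++⁺ h h′)
        ( separated (λ ()) projection-corners (negated-corners negations?)
        , ++-separated projection-corners (λ ()) (constant-corners false const0?)
            (λ ()) (constant-corners true const1?)))
    where
    negated-distinct : ∀ b → AllPairs (λ f g → ¬ f ≗ g) (negated b)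
    negated-distinct false = []
    negated-distinct true  = AllPairs.map⁺ (AllPairs.map (λ f≗̸g e → f≗̸g (λ x → Bool.not-injective (e x))) (projections-distinct n))
    constant-distinct : ∀ v b → AllPairs (λ f g → ¬ f ≗ g) (constant v b)
    constant-distinct v false = []
    constant-distinct v true  = [] ∷ []
    projection-corners : All (λ g → corners g ≡ (false , true)) (projections n)
    projection-corners = All.map⁺ (All.tabulate⁺ {f = id} (λ j → cong₂ _,_ (Vec.lookup-replicate j false) (Vec.lookup-replicate j true)))
    negated-corners : ∀ b → All (λ g → corners g ≡ (true , false)) (negated b)
    negated-corners false = []
    negated-corners true  = All.map⁺ (All.map (cong (λ (a , b) → not a , not b)) projection-corners)
    constant-corners : ∀ v b → All (λ g → corners g ≡ (v , v)) (constant v b)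
    constant-corners v false = []
    constant-corners v true  = refl ∷ []
    ++-separated : ∀ {a b c} {xs ys zs : List (BoolFun n)} → All (λ g → corners g ≡ a) xs →
      a ≢ b → All (λ g → corners g ≡ b) ys → a ≢ c → All (λ g → corners g ≡ c) zs →
      All (λ f → All (λ g → ¬ f ≗ g) (ys ++ zs)) xs
    ++-separated hx a≢b hy a≢c hz = All.zipWith (λ (h , h′) → All.++⁺ h h′) (separated a≢b hx hy , separated a≢c hx hz)

  length-elements : length (elements S n) ℕ.≤ 2 ℕ.* suc n
  length-elements = begin
    length (elements S n)
      ≡⟨ trans (List.length-++ (projections n)) (cong (length (projections n) ℕ.+_)
           (trans (List.length-++ (negated negations?)) (cong (length (negated negations?) ℕ.+_)
             (List.length-++ (constant false const0?))))) ⟩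
    length (projections n) ℕ.+ (length (negated negations?) ℕ.+ (length (constant false const0?) ℕ.+ length (constant true const1?)))
      ≤⟨ ℕ.+-mono-≤ (ℕ.≤-reflexive length-projections)
           (ℕ.+-mono-≤ (length-negated negations?) (ℕ.+-mono-≤ (length-constant false const0?) (length-constant true const1?))) ⟩
    n ℕ.+ (n ℕ.+ (1 ℕ.+ 1))
      ≡⟨ solve 1 (λ n → n :+ (n :+ con 2) := con 2 :* (con 1 :+ n)) refl n ⟩
    2 ℕ.* suc n ∎
    where
    open ℕ.≤-Reasoning
    open ℕSolver.+-*-Solver
    length-projections : length (projections n) ≡ n
    length-projections = trans (List.length-map _ (List.allFin n)) (List.length-tabulate id)
    length-negated : ∀ b → length (negated b) ℕ.≤ n
    length-negated false = ℕ.z≤n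
    length-negated true  = ℕ.≤-reflexive (trans (List.length-map _ (projections n)) length-projections)
    length-constant : ∀ v b → length (constant v b) ℕ.≤ 1
    length-constant v false = ℕ.z≤n
    length-constant v true  = ℕ.≤-refl

-- As the listed elements are distinct, the expectation under the initial
-- distribution is the plain average over the list.
𝔼-μ : ∀ S .{{_ : NonZero n}} F → Extensional F → 𝔼 (μ S {n}) F ≡ weight S n * ∑ (elements S n) F
𝔼-μ {n} S F ext = begin
  ∑ fs (λ f → μ S f * F f)
    ≡⟨ ∑-cong fs (λ f → trans (cong (_* F f) (trans (μ-𝟙 S f) (cong (_* w) (𝟙-any (elements-distinct S n) f))))
         (trans (cong (λ z → z * w * F f) (∑-cong es (λ e → 𝟙-cong (f ≗? e) (e ≗? f) (sym ∘_) (sym ∘_))))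
           (solve 3 (λ a b c → a :* b :* c := b :* (a :* c)) refl (∑ es (λ e → 𝟙 (e ≗? f))) w (F f)))) ⟩
  ∑ fs (λ f → w * (∑ es (λ e → 𝟙 (e ≗? f)) * F f))
    ≡⟨ ∑-*ˡ fs w _ ⟩
  w * ∑ fs (λ f → ∑ es (λ e → 𝟙 (e ≗? f)) * F f)
    ≡⟨ cong (w *_) (trans (∑-cong fs (λ f → sym (∑-*ʳ es (F f) _))) (∑-swap fs es _)) ⟩
  w * ∑ es (λ e → ∑ fs (λ f → 𝟙 (e ≗? f) * F f))
    ≡⟨ cong (w *_) (∑-cong es (∑-point F ext)) ⟩
  w * ∑ es F ∎
  where
  open ≡-Reasoning
  open +-*-Solver
  w = weight S n
  fs = allBoolFuns n
  es = elements S n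

∑-sign-counts : ∀ (xs : List A) (b : A → Bool) →
  ∃[ p ] ∃[ q ] (p ℕ.+ q ≡ length xs × ∑ xs (sign ∘ b) ≡ ι p - ι q)
∑-sign-counts []       b = 0 , 0 , refl , sym (ℚ.+-inverseʳ (ι 0))
∑-sign-counts (x ∷ xs) b with p , q , h , e ← ∑-sign-counts xs b | b x
... | false = suc p , q , cong suc h , trans (cong (1ℚ +_) e)
  (trans (sym (ℚ.+-assoc 1ℚ (ι p) (- ι q))) (cong (_- ι q) (sym (ι-suc p))))
... | true  = p , suc q , trans (ℕ.+-suc p q) (cong suc h) , trans (cong (- 1ℚ +_) e)
  (trans (solve 2 (λ p q → :- con 1ℚ :+ (p :- q)
         := p :- (con 1ℚ :+ q)) refl (ι p) (ι q)) (cong (λ z → ι p - z) (sym (ι-suc q))))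
  where
  open +-*-Solver

-- A sum of N signs is ±N when they all agree, and has absolute value at most
-- N - 2 otherwise.
∑-sign-dichotomy : ∀ (xs : List A) (b : A → Bool) →
  (∃[ v ] ∑ xs (sign ∘ b) ≡ ι (length xs) * sign v) ⊎
  (∃[ t ] (t ℕ.+ 2 ≡ length xs × ∣ ∑ xs (sign ∘ b) ∣ ≤ ι t))
∑-sign-dichotomy xs b with ∑-sign-counts xs b
... | p , zero , h , e = inj₁ (false , trans e (trans (cong₂ _-_ (cong ι (trans (sym (ℕ.+-identityʳ p)) h)) ι-0)
  (solve 1 (λ x → x :- con 0ℚ := x :* con 1ℚ) refl (ι (length xs)))))
  where
  open +-*-Solver
... | zero , q , h , e = inj₁ (true , trans e (trans (cong₂ _-_ ι-0 (cong ι h))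
  (solve 1 (λ x → con 0ℚ :- x := x :* (:- con 1ℚ)) refl (ι (length xs)))))
  where
  open +-*-Solver
... | suc p , suc q , h , e = inj₂ (p ℕ.+ q ,
    trans (trans (ℕ.+-comm (p ℕ.+ q) 2) (cong suc (sym (ℕ.+-suc p q)))) h , (begin
  ∣ ∑ xs (sign ∘ b) ∣        ≡⟨ cong ∣_∣ (trans e (trans (cong₂ _-_ (ι-suc p) (ι-suc q))
                                 (solve 2 (λ p q → (con 1ℚ :+ p) :- (con 1ℚ :+ q)
                                        := p :- q) refl (ι p) (ι q)))) ⟩
  ∣ ι p - ι q ∣              ≤⟨ ℚ.∣p-q∣≤∣p∣+∣q∣ (ι p) (ι q) ⟩
  ∣ ι p ∣ + ∣ ι q ∣          ≡⟨ cong₂ _+_ (∣ι∣ p) (∣ι∣ q) ⟩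
  ι p + ι q                  ≡⟨ ι-+ p q ⟨
  ι (p ℕ.+ q)                ∎))
  where
  open ℚ.≤-Reasoning
  open +-*-Solver

-- The bound n/(n+1) on the initial coefficients of absolute value less than 1.
ρ : ℕ → ℚ
ρ n = ℤ.+ n ℚ./ suc n

weight-ι : ∀ S n .{{_ : NonZero n}} → weight S n * ι (length (elements S n)) ≡ 1ℚ
weight-ι S (suc m) = trans (/-cancel 1 (ℕ.pred (length (elements S (suc m))))) ι-1

weight-ι-≤ρ : ∀ S n .{{_ : NonZero n}} t → t ℕ.+ 2 ≡ length (elements S n) → weight S n * ι t ≤ ρ n
weight-ι-≤ρ S n@(suc m) t t+2≡N = subst (_≤ ρ n) (sym (/-*-ι 1 t d)) (/-mono-≤ (1 ℕ.* t) n d n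
  (ℕ.+-cancelʳ-≤ (2 ℕ.* suc n) _ _ (begin
    1 ℕ.* t ℕ.* suc n ℕ.+ 2 ℕ.* suc n
      ≡⟨ solve 2 (λ t n → con 1 :* t :* (con 1 :+ n) :+ con 2 :* (con 1 :+ n)
             := n :* (t :+ con 2) :+ (t :+ con 2)) refl t n ⟩
    n ℕ.* (t ℕ.+ 2) ℕ.+ (t ℕ.+ 2)
      ≡⟨ cong (λ z → n ℕ.* z ℕ.+ z) t+2≡N ⟩
    n ℕ.* suc d ℕ.+ suc d
      ≤⟨ ℕ.+-monoʳ-≤ (n ℕ.* suc d) (length-elements S n) ⟩
    n ℕ.* suc d ℕ.+ 2 ℕ.* suc n ∎)))
  where
  open ℕ.≤-Reasoning
  open ℕSolver.+-*-Solver
  d = ℕ.pred (length (elements S n))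

weight-nonNeg : ∀ S n .{{_ : NonZero n}} → ℚ.NonNegative (weight S n)
weight-nonNeg S (suc m) = ℚ.normalize-nonNeg 1 (length (elements S (suc m)))

-- N ≤ 2n+2 turns the bound (N-2)/N on a mixed average into n/(n+1).
𝔼-μ-χ : ∀ S .{{_ : NonZero n}} s → (∃[ v ] 𝔼 (μ S {n}) (χ s) ≡ sign v) ⊎ ∣ 𝔼 (μ S {n}) (χ s) ∣ ≤ ρ n
𝔼-μ-χ {n} S s = [ inj₁ ∘ unanimous , inj₂ ∘ mixed ]′ (∑-sign-dichotomy es (exponent s))
  where
  es = elements S n
  w = weight S n
  unanimous : ∃[ v ] ∑ es (χ s) ≡ ι (length es) * sign v → ∃[ v ] 𝔼 (μ S {n}) (χ s) ≡ sign v
  unanimous (v , h) = v , trans (𝔼-μ S (χ s) (χ-extensional s)) (trans (cong (w *_) h)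
    (trans (sym (ℚ.*-assoc w (ι (length es)) (sign v))) (trans (cong (_* sign v) (weight-ι S n)) (ℚ.*-identityˡ (sign v)))))
  mixed : ∃[ t ] (t ℕ.+ 2 ≡ length es × ∣ ∑ es (χ s) ∣ ≤ ι t) → ∣ 𝔼 (μ S {n}) (χ s) ∣ ≤ ρ n
  mixed (t , t+2≡N , h) = begin
    ∣ 𝔼 (μ S) (χ s) ∣      ≡⟨ cong ∣_∣ (𝔼-μ S (χ s) (χ-extensional s)) ⟩
    ∣ w * ∑ es (χ s) ∣     ≡⟨ ℚ.∣p*q∣≡∣p∣*∣q∣ w (∑ es (χ s)) ⟩
    ∣ w ∣ * ∣ ∑ es (χ s) ∣ ≡⟨ cong (_* ∣ ∑ es (χ s) ∣) (ℚ.0≤p⇒∣p∣≡p (ℚ.nonNegative⁻¹ w {{weight-nonNeg S n}})) ⟩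
    w * ∣ ∑ es (χ s) ∣     ≤⟨ ℚ.*-monoˡ-≤-nonNeg w {{weight-nonNeg S n}} h ⟩
    w * ι t                ≤⟨ weight-ι-≤ρ S n t t+2≡N ⟩
    ρ n                    ∎
    where
    open ℚ.≤-Reasoning

-- The zero frequency gives the trivial character.
χ-trivial : ∀ (g : BoolFun n) → χ (replicate (suc n) false) g ≡ 1ℚ
χ-trivial {n} g = cong sign (Bool.xor-same (g (replicate n false)))

𝔼-μ-trivial : ∀ S .{{_ : NonZero n}} → 𝔼 (μ S {n}) (χ (replicate (suc n) false)) ≡ 1ℚ
𝔼-μ-trivial {n} S = begin
  𝔼 (μ S {n}) (χ 0⃗)       ≡⟨ 𝔼-μ S (χ 0⃗) (χ-extensional 0⃗) ⟩
  weight S n * ∑ es (χ 0⃗)  ≡⟨ cong (weight S n *_) (trans (∑-cong es χ-trivial) (∑-1 es)) ⟩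
  weight S n * ι (length es)  ≡⟨ weight-ι S n ⟩
  1ℚ ∎
  where
  open ≡-Reasoning
  es = elements S n
  0⃗ = replicate (suc n) false
  ∑-1 : (xs : List (BoolFun n)) → ∑ xs (const 1ℚ) ≡ ι (length xs)
  ∑-1 []       = sym ι-0
  ∑-1 (x ∷ xs) = trans (cong (1ℚ +_) (∑-1 xs)) (sym (ι-suc (length xs)))

------------------------------------------------------------------------
-- Evolution of the Fourier coefficients

-- A map of a two-element set has period at most 2 on its image.
thrice : (t : Bool → Bool) → ∀ b → t (t (t b)) ≡ t b
thrice t false with t false in e
... | false = trans (cong t e) e
... | true  with t true in e′
...   | true  = e′
...   | false = e
thrice t true with t true in e
... | true = trans (cong t e) e
... | false with t false in e′
...   | false = e′
...   | true  = e

-- The sum of k copies of b over GF(2), that is, b when k is odd and 0 when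
-- k is even.
parity : ℕ → Bool → Bool
parity zero    b = false
parity (suc k) b = b xor parity k b

sign-^ : ∀ b k → sign b ^ k ≡ sign (parity k b)
sign-^ b zero    = refl
sign-^ b (suc k) = trans (cong (sign b *_) (sign-^ b k)) (sym (sign-xor b (parity k b)))

-- The Fourier coefficient of the i-th distribution at frequency s.
transform : InitialSet → ∀ k → Bool → .{{NonZero n}} → ℕ → Vec Bool (suc n) → ℚ
transform {n} S k c i s = 𝔼 (growth {k} {n} S (linearConnective c) i) (χ s)

module _ (S : InitialSet) (k : ℕ) (c : Bool) .{{_ : NonZero n}} where

  private
    a : ℕ → Vec Bool (suc n) → ℚ
    a = transform {n} S k c

  transform-suc : ∀ i s → a (suc i) s ≡ χ s (const c) * a i s ^ k
  transform-suc i s = 𝔼-χ-grow {k = k} c (growth {k} {n} S (linearConnective c) i) s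

  ∣transform∣ : ∀ i s → ∣ a i s ∣ ≡ ∣ a 0 s ∣ ^ (k ℕ.^ i)
  ∣transform∣ zero    s = sym (ℚ.*-identityʳ ∣ a 0 s ∣)
  ∣transform∣ (suc i) s = begin
    ∣ a (suc i) s ∣                     ≡⟨ cong ∣_∣ (transform-suc i s) ⟩
    ∣ χ s (const c) * a i s ^ k ∣       ≡⟨ ℚ.∣p*q∣≡∣p∣*∣q∣ (χ s (const c)) (a i s ^ k) ⟩
    ∣ χ s (const c) ∣ * ∣ a i s ^ k ∣   ≡⟨ cong₂ _*_ (∣sign∣ (exponent s (const c))) (∣^∣ (a i s) k) ⟩
    1ℚ * ∣ a i s ∣ ^ k                  ≡⟨ ℚ.*-identityˡ (∣ a i s ∣ ^ k) ⟩
    ∣ a i s ∣ ^ k                       ≡⟨ cong (_^ k) (∣transform∣ i s) ⟩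
    (∣ a 0 s ∣ ^ (k ℕ.^ i)) ^ k         ≡⟨ ^-assocʳ ∣ a 0 s ∣ (k ℕ.^ i) k ⟩
    ∣ a 0 s ∣ ^ (k ℕ.^ i ℕ.* k)         ≡⟨ cong (∣ a 0 s ∣ ^_) (ℕ.*-comm (k ℕ.^ i) k) ⟩
    ∣ a 0 s ∣ ^ (k ℕ.^ suc i)           ∎
    where
    open ≡-Reasoning

  transform-periodic : ∀ s v → a 0 s ≡ sign v → ∀ i t → a (suc (t ℕ.* 2 ℕ.+ i)) s ≡ a (suc i) s
  transform-periodic s v a₀≡±1 i t = trans (a≡sign (suc (t ℕ.* 2 ℕ.+ i)))
    (trans (cong sign (b-periodic t)) (sym (a≡sign (suc i))))
    where
    -- The recursion for the coefficients, read on exponents of -1.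
    τ : Bool → Bool
    τ b = exponent s (const c) xor parity k b
    b : ℕ → Bool
    b zero    = v
    b (suc i) = τ (b i)
    a≡sign : ∀ i → a i s ≡ sign (b i)
    a≡sign zero    = a₀≡±1
    a≡sign (suc i) = trans (transform-suc i s) (trans
      (cong (χ s (const c) *_) (trans (cong (_^ k) (a≡sign i)) (sign-^ (b i) k)))
      (sym (sign-xor (exponent s (const c)) (parity k (b i)))))
    b-periodic : ∀ t → b (suc (t ℕ.* 2 ℕ.+ i)) ≡ b (suc i)
    b-periodic zero    = refl
    b-periodic (suc t) = trans (thrice τ (b (t ℕ.* 2 ℕ.+ i))) (b-periodic t)

------------------------------------------------------------------------
-- The bound on decaying coefficients

0≤ρ : ∀ n → 0ℚ ≤ ρ n
0≤ρ n = ℚ.nonNegative⁻¹ (ρ n) {{ℚ.normalize-nonNeg n (suc n)}}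

ρ≤1 : ∀ n → ρ n ≤ 1ℚ
ρ≤1 n = /-mono-≤ n 1 n 0 (ℕ.≤-trans (ℕ.≤-reflexive (ℕ.*-identityʳ n)) (ℕ.≤-trans (ℕ.n≤1+n n) (ℕ.≤-reflexive (sym (ℕ.+-identityʳ (suc n))))))

ρ^-ι : ∀ n m → ρ n ^ m * ι (suc n ℕ.^ m) ≡ ι (n ℕ.^ m)
ρ^-ι n zero    = ℚ.*-identityˡ (ι 1)
ρ^-ι n (suc m) = begin
  ρ n * ρ n ^ m * ι (suc n ℕ.* suc n ℕ.^ m)
    ≡⟨ cong (ρ n * ρ n ^ m *_) (ι-* (suc n) (suc n ℕ.^ m)) ⟩
  ρ n * ρ n ^ m * (ι (suc n) * ι (suc n ℕ.^ m))
    ≡⟨ solve 4 (λ a b c d → a :* b :* (c :* d)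
           := (a :* c) :* (b :* d)) refl (ρ n) (ρ n ^ m) (ι (suc n)) (ι (suc n ℕ.^ m)) ⟩
  ρ n * ι (suc n) * (ρ n ^ m * ι (suc n ℕ.^ m))
    ≡⟨ cong₂ _*_ (/-cancel n n) (ρ^-ι n m) ⟩
  ι n * ι (n ℕ.^ m)
    ≡⟨ ι-* n (n ℕ.^ m) ⟨
  ι (n ℕ.* n ℕ.^ m) ∎
  where
  open ≡-Reasoning
  open +-*-Solver

-- The bound on every coefficient that is initially of absolute value less
-- than 1, at all times i with k^i > n².
decay : ℕ → ℚ
decay n = ρ n ^ suc (n ℕ.* n)

-- With r = decay n: (2^(n+1) - 1) r < 1.
decay-small : ∀ n .{{_ : NonZero n}} → ι (2 ℕ.^ suc n) * decay n ℚ.< 1ℚ + decay n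
decay-small n@(suc p) = ℚ.*-cancelʳ-<-nonNeg D {{ℚ.nonNegative (0≤ι (suc n ℕ.^ M))}} (begin-strict
  ι (2 ℕ.^ suc n) * decay n * D   ≡⟨ ℚ.*-assoc (ι (2 ℕ.^ suc n)) (decay n) D ⟩
  ι (2 ℕ.^ suc n) * (decay n * D) ≡⟨ cong (ι (2 ℕ.^ suc n) *_) (ρ^-ι n M) ⟩
  ι (2 ℕ.^ suc n) * ι (n ℕ.^ M)   ≡⟨ ι-* (2 ℕ.^ suc n) (n ℕ.^ M) ⟨
  ι (2 ℕ.^ suc n ℕ.* n ℕ.^ M)     <⟨ ι-mono-< (power-bound p) ⟩
  ι (suc n ℕ.^ M ℕ.+ n ℕ.^ M)     ≡⟨ ι-+ (suc n ℕ.^ M) (n ℕ.^ M) ⟩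
  D + ι (n ℕ.^ M)                 ≡⟨ cong (D +_) (ρ^-ι n M) ⟨
  D + decay n * D                 ≡⟨ solve 2 (λ d r → d :+ r :* d := (con 1ℚ :+ r) :* d) refl D (decay n) ⟩
  (1ℚ + decay n) * D              ∎)
  where
  open ℚ.≤-Reasoning
  open +-*-Solver
  M = suc (n ℕ.* n)
  D = ι (suc n ℕ.^ M)

------------------------------------------------------------------------
-- Comparison of the distributions at two times of equal parity

-- A function bounded by β that is at most 0 at the zero vector has sum at most
-- (2^n - 1) β.
∑-bits-bound : ∀ n (F : Vec Bool n → ℚ) β → F (replicate n false) ≤ 0ℚ → (∀ s → F s ≤ β) →
  ∑ (bits n) F + β ≤ ι (2 ℕ.^ n) * β
∑-bits-bound zero F β F0≤0 F≤β = begin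
  F [] + 0ℚ + β  ≤⟨ ℚ.+-monoˡ-≤ β (ℚ.+-monoˡ-≤ 0ℚ F0≤0) ⟩
  0ℚ + 0ℚ + β    ≡⟨ ℚ.+-identityˡ β ⟩
  β              ≡⟨ trans (cong (_* β) ι-1) (ℚ.*-identityˡ β) ⟨
  ι 1 * β        ∎
  where
  open ℚ.≤-Reasoning
∑-bits-bound (suc n) F β F0≤0 F≤β = begin
  ∑ (bits (suc n)) F + β                      ≡⟨ cong (_+ β) (∑-bits n F) ⟩
  X + Y + β                                   ≡⟨ solve 3 (λ x y b → x :+ y :+ b := (x :+ b) :+ y) refl X Y β ⟩
  (X + β) + Y                                 ≤⟨ ℚ.+-mono-≤ (∑-bits-bound n (F ∘ (false ∷_)) β F0≤0 (F≤β ∘ (false ∷_)))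
                                                   (∑-mono (bits n) (F≤β ∘ (true ∷_))) ⟩
  ι (2 ℕ.^ n) * β + ∑ (bits n) (const β)      ≡⟨ cong (_+ ∑ (bits n) (const β)) (∑-bits-const n β) ⟨
  ∑ (bits n) (const β) + ∑ (bits n) (const β) ≡⟨ ∑-bits n (const β) ⟨
  ∑ (bits (suc n)) (const β)                  ≡⟨ ∑-bits-const (suc n) β ⟩
  ι (2 ℕ.^ suc n) * β                         ∎
  where
  open ℚ.≤-Reasoning
  open +-*-Solver
  X = ∑ (bits n) (F ∘ (false ∷_))
  Y = ∑ (bits n) (F ∘ (true ∷_))

-- The earlier time is suc i; the later times are those of the same parity.
module _ (S : InitialSet) {k : ℕ} (1<k : 1 < k) (c : Bool) .{{n≢0 : NonZero n}}
         (i : ℕ) (n²<k^ : n ℕ.* n < k ℕ.^ suc i) where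

  private
    a : ℕ → Vec Bool (suc n) → ℚ
    a = transform {n} S k c
    p : ℕ → Dist n
    p = growth {k} {n} S (linearConnective c)
    instance
      k≢0 : NonZero k
      k≢0 = ℕ.>-nonZero (ℕ.<-trans (ℕ.s≤s ℕ.z≤n) 1<k)

  -- The power k^j exceeds n² at the earlier time and at all later ones.
  transform-decay : ∀ s → ∣ a 0 s ∣ ≤ ρ n → ∀ j → suc i ℕ.≤ j → ∣ a j s ∣ ≤ decay n
  transform-decay s small j i<j = begin
    ∣ a j s ∣                   ≡⟨ ∣transform∣ S k c j s ⟩
    ∣ a 0 s ∣ ^ (k ℕ.^ j)       ≤⟨ ^-mono-≤ (ℚ.0≤∣p∣ (a 0 s)) small (k ℕ.^ j) ⟩
    ρ n ^ (k ℕ.^ j)             ≤⟨ ^-antimono-≤ (0≤ρ n) (ρ≤1 n) (ℕ.≤-trans n²<k^ (ℕ.^-monoʳ-≤ k i<j)) ⟩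
    decay n                     ∎
    where
    open ℚ.≤-Reasoning

  transform-close : ∀ t s → ∣ a (suc (t ℕ.* 2 ℕ.+ i)) s - a (suc i) s ∣ ≤ decay n + decay n
  transform-close t s = [ unimodular , decaying ]′ (𝔼-μ-χ S s)
    where
    open ℚ.≤-Reasoning
    j = suc (t ℕ.* 2 ℕ.+ i)
    0≤decay = 0≤^ (0≤ρ n) (suc (n ℕ.* n))
    unimodular : ∃[ v ] a 0 s ≡ sign v → ∣ a j s - a (suc i) s ∣ ≤ decay n + decay n
    unimodular (v , e) = begin
      ∣ a j s - a (suc i) s ∣        ≡⟨ cong (λ z → ∣ z - a (suc i) s ∣) (transform-periodic S k c s v e i t) ⟩
      ∣ a (suc i) s - a (suc i) s ∣  ≡⟨ cong ∣_∣ (ℚ.+-inverseʳ (a (suc i) s)) ⟩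
      0ℚ + 0ℚ                        ≤⟨ ℚ.+-mono-≤ 0≤decay 0≤decay ⟩
      decay n + decay n              ∎
    decaying : ∣ a 0 s ∣ ≤ ρ n → ∣ a j s - a (suc i) s ∣ ≤ decay n + decay n
    decaying small = ℚ.≤-trans (ℚ.∣p-q∣≤∣p∣+∣q∣ (a j s) (a (suc i) s))
      (ℚ.+-mono-≤ (transform-decay s small j (ℕ.s≤s (ℕ.m≤n+m i (t ℕ.* 2)))) (transform-decay s small (suc i) ℕ.≤-refl))

  transform-trivial : ∀ t → let 0⃗ = replicate (suc n) false in ∣ a (suc (t ℕ.* 2 ℕ.+ i)) 0⃗ - a (suc i) 0⃗ ∣ ≤ 0ℚ
  transform-trivial t = ℚ.≤-reflexive (cong ∣_∣ (trans
    (cong (_- a (suc i) 0⃗) (transform-periodic S k c 0⃗ false (𝔼-μ-trivial S) i t)) (ℚ.+-inverseʳ (a (suc i) 0⃗))))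
    where 0⃗ = replicate (suc n) false

  -- The quantity (2^(n+1) - 1) · 2r, where r = decay n.
  gapBound : ℚ
  gapBound = ι (2 ℕ.^ suc n) * (decay n + decay n) - (decay n + decay n)

  gapBound<2 : gapBound ℚ.< 1ℚ + 1ℚ
  gapBound<2 = begin-strict
    gapBound
      ≡⟨ solve 2 (λ e d → e :* (d :+ d) :- (d :+ d)
             := (e :* d :+ e :* d) :- (d :+ d)) refl (ι (2 ℕ.^ suc n)) (decay n) ⟩
    (ι (2 ℕ.^ suc n) * decay n + ι (2 ℕ.^ suc n) * decay n) - (decay n + decay n)
      <⟨ ℚ.+-monoˡ-< (- (decay n + decay n)) (ℚ.+-mono-< (decay-small n) (decay-small n)) ⟩
    ((1ℚ + decay n) + (1ℚ + decay n)) - (decay n + decay n)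
      ≡⟨ solve 1 (λ d → ((con 1ℚ :+ d) :+ (con 1ℚ :+ d)) :- (d :+ d) := con 1ℚ :+ con 1ℚ) refl (decay n) ⟩
    1ℚ + 1ℚ ∎
    where
    open ℚ.≤-Reasoning
    open +-*-Solver

  -- 2^(n+1) |πⱼ(f) - πᵢ(f)| is at most the sum over s of |aⱼ(s) - aᵢ(s)|, and the
  -- trivial character contributes nothing to that sum.
  scaled-gap : ∀ t f → IsLinear f → ι (2 ℕ.^ suc n) * ∣ p (suc (t ℕ.* 2 ℕ.+ i)) f - p (suc i) f ∣ ≤ gapBound
  scaled-gap t f lf = begin
    E * ∣ Δ ∣
      ≡⟨ cong (_* ∣ Δ ∣) (∣ι∣ (2 ℕ.^ suc n)) ⟨
    ∣ E ∣ * ∣ Δ ∣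
      ≡⟨ ℚ.∣p*q∣≡∣p∣*∣q∣ E Δ ⟨
    ∣ E * Δ ∣
      ≡⟨ cong ∣_∣ (trans (solve 3 (λ e x y → e :* (x :- y)
             := e :* x :+ (:- con 1ℚ) :* (e :* y)) refl E (p j f) (p (suc i) f))
           (cong₂ (λ x y → x + - 1ℚ * y) (sym (invert j)) (sym (invert (suc i))))) ⟩
    ∣ ∑ ss (λ s → χ s f * a j s) + - 1ℚ * ∑ ss (λ s → χ s f * a (suc i) s) ∣
      ≡⟨ cong ∣_∣ (trans (cong (∑ ss (λ s → χ s f * a j s) +_) (sym (∑-*ˡ ss (- 1ℚ) _))) (trans (sym (∑-+ ss _ _))
           (∑-cong ss (λ s → solve 3 (λ x u v → x :* u :+ (:- con 1ℚ) :* (x :* v)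
                  := x :* (u :- v)) refl (χ s f) (a j s) (a (suc i) s))))) ⟩
    ∣ ∑ ss (λ s → χ s f * (a j s - a (suc i) s)) ∣
      ≤⟨ ∣∑∣≤∑∣∣ ss _ ⟩
    ∑ ss (λ s → ∣ χ s f * (a j s - a (suc i) s) ∣)
      ≡⟨ ∑-cong ss (λ s → trans (ℚ.∣p*q∣≡∣p∣*∣q∣ (χ s f) (a j s - a (suc i) s))
           (trans (cong (_* ∣ a j s - a (suc i) s ∣) (∣sign∣ (exponent s f))) (ℚ.*-identityˡ ∣ a j s - a (suc i) s ∣))) ⟩
    X
      ≡⟨ solve 2 (λ x b → x := (x :+ b) :- b) refl X (decay n + decay n) ⟩
    X + (decay n + decay n) - (decay n + decay n)
      ≤⟨ ℚ.+-monoˡ-≤ (- (decay n + decay n))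
           (∑-bits-bound (suc n) (λ s → ∣ a j s - a (suc i) s ∣) (decay n + decay n) (transform-trivial t) (transform-close t)) ⟩
    gapBound ∎
    where
    open ℚ.≤-Reasoning
    open +-*-Solver
    ss = bits (suc n)
    j = suc (t ℕ.* 2 ℕ.+ i)
    E = ι (2 ℕ.^ suc n)
    Δ = p j f - p (suc i) f
    X = ∑ ss (λ s → ∣ a j s - a (suc i) s ∣)
    invert : ∀ j → ∑ ss (λ s → χ s f * a j s) ≡ E * p j f
    invert j = inversion (growth-extensional S (linearConnective {k} c) j) (growth-support {k = k} S c j) lf

  -- A bound B below 2^(-n), uniform in the later time; the strict inequality
  -- leaves room for the limit.
  growth-close : ∃[ B ] (B ℚ.< 2^- n × (∀ t f → IsLinear f → ∣ p (suc (t ℕ.* 2 ℕ.+ i)) f - p (suc i) f ∣ ≤ B))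
  growth-close = h * ½ * gapBound , below , bound
    where
    open ℚ.≤-Reasoning
    open +-*-Solver
    h = 2^- n
    h⁺ : ∀ N .{{_ : NonZero N}} → ℚ.Positive (ℤ.+ 1 ℚ./ N)
    h⁺ N = ℚ.normalize-pos 1 N
    1/N*N : ∀ N .{{_ : NonZero N}} → (ℤ.+ 1 ℚ./ N) * ι N ≡ 1ℚ
    1/N*N (suc d) = trans (/-cancel 1 d) ι-1
    instance
      2^n≢0 : NonZero (2 ℕ.^ n)
      2^n≢0 = ℕ.m^n≢0 2 n
      h½⁺ : ℚ.Positive (h * ½)
      h½⁺ = ℚ.pos*pos⇒pos h {{h⁺ (2 ℕ.^ n)}} ½
    below : h * ½ * gapBound ℚ.< h
    below = begin-strict
      h * ½ * gapBound          <⟨ ℚ.*-monoʳ-<-pos (h * ½) gapBound<2 ⟩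
      h * ½ * (1ℚ + 1ℚ)  ≡⟨ solve 1 (λ h → h :* con ½ :* (con 1ℚ :+ con 1ℚ) := h) refl h ⟩
      h                  ∎
    bound : ∀ t f → IsLinear f → ∣ p (suc (t ℕ.* 2 ℕ.+ i)) f - p (suc i) f ∣ ≤ h * ½ * gapBound
    bound t f lf = begin
      D                                      ≡⟨ ℚ.*-identityˡ D ⟨
      1ℚ * D                                 ≡⟨ cong (_* D) (1/N*N (2 ℕ.^ n)) ⟨
      h * ι (2 ℕ.^ n) * D                    ≡⟨ solve 3 (λ h g d → h :* g :* d
             := h :* con ½ :* ((con 1ℚ :+ con 1ℚ) :* g :* d)) refl h (ι (2 ℕ.^ n)) D ⟩
      h * ½ * ((1ℚ + 1ℚ) * ι (2 ℕ.^ n) * D)  ≡⟨ cong (λ z → h * ½ * (z * D)) (trans (cong (_* ι (2 ℕ.^ n)) (sym ι-2)) (sym (ι-* 2 (2 ℕ.^ n)))) ⟩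
      h * ½ * (ι (2 ℕ.^ suc n) * D)          ≤⟨ ℚ.*-monoˡ-≤-nonNeg (h * ½) {{ℚ.pos⇒nonNeg (h * ½)}} (scaled-gap t f lf) ⟩
      h * ½ * gapBound                              ∎
      where
      D = ∣ p (suc (t ℕ.* 2 ℕ.+ i)) f - p (suc i) f ∣
      ι-2 : ι 2 ≡ 1ℚ + 1ℚ
      ι-2 = trans (ι-suc 1) (cong (1ℚ +_) ι-1)

------------------------------------------------------------------------
-- From logarithms to powers

log-cross : ∀ n k i s → .{{NonZero k}} → k ℕ.^ i ℕ.≤ n ℕ.* n →
  ⌊log₂ (k ℕ.^ s) ⌋ ℕ.* i < suc ⌊log₂ (n ℕ.^ s) ⌋ ℕ.* 2
log-cross n k i s kⁱ≤n² = 2^-cancel-< (begin-strict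
  2 ℕ.^ (q ℕ.* i)        ≡⟨ ℕ.^-*-assoc 2 q i ⟨
  (2 ℕ.^ q) ℕ.^ i        ≤⟨ ℕ.^-monoˡ-≤ i (2^⌊log₂⌋≤ (k ℕ.^ s) {{ℕ.m^n≢0 k s}}) ⟩
  (k ℕ.^ s) ℕ.^ i        ≡⟨ ^-swap k s i ⟩
  (k ℕ.^ i) ℕ.^ s        ≤⟨ ℕ.^-monoˡ-≤ s (ℕ.≤-trans kⁱ≤n² (ℕ.≤-reflexive (cong (n ℕ.*_) (sym (ℕ.*-identityʳ n))))) ⟩
  (n ℕ.^ 2) ℕ.^ s        ≡⟨ ^-swap n 2 s ⟩
  (n ℕ.^ s) ℕ.^ 2        <⟨ ℕ.^-monoˡ-< 2 (<2^suc⌊log₂⌋ (n ℕ.^ s)) ⟩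
  (2 ℕ.^ suc p) ℕ.^ 2    ≡⟨ ℕ.^-*-assoc 2 (suc p) 2 ⟩
  2 ℕ.^ (suc p ℕ.* 2)    ∎)
  where
  open ℕ.≤-Reasoning
  p = ⌊log₂ (n ℕ.^ s) ⌋
  q = ⌊log₂ (k ℕ.^ s) ⌋
  ^-swap : ∀ a b c → (a ℕ.^ b) ℕ.^ c ≡ (a ℕ.^ c) ℕ.^ b
  ^-swap a b c = trans (ℕ.^-*-assoc a b c) (trans (cong (a ℕ.^_) (ℕ.*-comm b c)) (sym (ℕ.^-*-assoc a c b)))

n≤⌊log₂k^n⌋ : ∀ {k} → 1 < k → ∀ s → s ℕ.≤ ⌊log₂ (k ℕ.^ s) ⌋
n≤⌊log₂k^n⌋ {k} 1<k s = subst (ℕ._≤ ⌊log₂ (k ℕ.^ s) ⌋) (⌊log₂[2^n]⌋≡n s) (⌊log₂⌋-mono-≤ (ℕ.^-monoˡ-≤ s 1<k))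

-- If k^i ≤ n², then ⌊log₂ k^s⌋ · i ≤ 2 ⌊log₂ n^s⌋ + 1 for every s.  A gap ε in the
-- hypothesis means ⌊log₂ k^s⌋ · i ≥ 2 ⌊log₂ n^s⌋ + ε ⌊log₂ k^s⌋ for large s, which is
-- impossible once ε s > 1, because ⌊log₂ k^s⌋ ≥ s.
n²<kⁱ : ∀ n k (1<k : 1 < k) i →
  (fromℕ 2 *ᴿ log₂ n) /ᴿ log₂ k [ 0<log₂ 1<k ] <ᴿ fromℕ i → n ℕ.* n < k ℕ.^ i
n²<kⁱ n k 1<k i (ε , ε>0 , N , gap) = ℕ.≰⇒> λ kⁱ≤n² → ℚ.<-irrefl refl (begin-strict
  1ℚ                             ≡⟨ trans (sym ι-1) (sym (/-cancel 1 m)) ⟩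
  (ℤ.+ 1 ℚ./ suc m) * ι (suc m)  ≤⟨ ℚ.*-monoʳ-≤-nonNeg (ι (suc m)) {{ℚ.nonNegative (0≤ι (suc m))}}
                                     (/-mono-≤ 1 1 m M (ℕ.*-monoʳ-≤ 1 (ℕ.s≤s (ℕ.m≤n⊔m N M)))) ⟩
  (ℤ.+ 1 ℚ./ suc M) * ι (suc m)  <⟨ ℚ.*-monoˡ-<-pos (ι (suc m)) {{ℚ.positive (ℚ.<-respˡ-≡ ι-0 (ι-mono-< {0} {suc m} (ℕ.s≤s ℕ.z≤n)))}}
                                     (proj₂ (archimedean ε ε>0)) ⟩
  ε * ι (suc m)                  ≤⟨ ℚ.*-monoˡ-≤-nonNeg ε {{ℚ.nonNegative (ℚ.<⇒≤ ε>0)}} (ι-mono-≤ (n≤⌊log₂k^n⌋ 1<k (suc m))) ⟩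
  ε * ι q                        ≡⟨ solve 2 (λ x y → y := (x :+ y) :- x) refl (ι 2 * ι p) (ε * ι q) ⟩
  ι 2 * ι p + ε * ι q - ι 2 * ι p  ≤⟨ ℚ.+-monoˡ-≤ (- (ι 2 * ι p)) scaled ⟩
  ι i * ι q - ι 2 * ι p          ≡⟨ cong₂ _-_ (trans (ℚ.*-comm (ι i) (ι q)) (sym (ι-* q i))) (sym (ι-* 2 p)) ⟩
  ι (q ℕ.* i) - ι (2 ℕ.* p)      ≤⟨ ℚ.+-monoˡ-≤ (- ι (2 ℕ.* p)) (ι-mono-≤ (ℕ.≤-trans (ℕ.≤-pred (log-cross n k i (suc m) kⁱ≤n²))
                                      (ℕ.≤-reflexive (cong suc (ℕ.*-comm p 2))))) ⟩
  ι (suc (2 ℕ.* p)) - ι (2 ℕ.* p)  ≡⟨ cong (_- ι (2 ℕ.* p)) (ι-suc (2 ℕ.* p)) ⟩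
  1ℚ + ι (2 ℕ.* p) - ι (2 ℕ.* p)  ≡⟨ solve 1 (λ x → (con 1ℚ :+ x) :- x := con 1ℚ) refl (ι (2 ℕ.* p)) ⟩
  1ℚ ∎)
  where
  open ℚ.≤-Reasoning
  open +-*-Solver
  instance
    k≢0 : NonZero k
    k≢0 = ℕ.>-nonZero (ℕ.<-trans (ℕ.s≤s ℕ.z≤n) 1<k)
  M = proj₁ (archimedean ε ε>0)
  m = N ℕ.⊔ M
  p = ⌊log₂ (n ℕ.^ suc m) ⌋
  q = ⌊log₂ (k ℕ.^ suc m) ⌋
  L = log₂-seq k m
  L>0 : ℚ.Positive L
  L>0 = ℚ.positive (/-mono-< 0 q 0 m (subst (0 <_) (sym (ℕ.*-identityʳ q)) (ℕ.<-≤-trans (ℕ.s≤s ℕ.z≤n) (n≤⌊log₂k^n⌋ 1<k (suc m)))))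
  -- The hypothesis at the index m, multiplied by the positive number
  -- S · L = ⌊log₂ k^s⌋, where s = m + 1 = S.
  scaled : ι 2 * ι p + ε * ι q ≤ ι i * ι q
  scaled = begin
    ι 2 * ι p + ε * ι q
      ≡⟨ cong₂ (λ x y → ι 2 * x + ε * y) (sym (/-cancel p m)) (sym (/-cancel q m)) ⟩
    ι 2 * (log₂-seq n m * S) + ε * (L * S)
      ≡⟨ cong (_+ ε * (L * S)) (trans (sym (ℚ.*-identityʳ (ι 2 * (log₂-seq n m * S)))) (cong (ι 2 * (log₂-seq n m * S) *_) (sym (inv-inverseʳ L {{L>0}})))) ⟩
    ι 2 * (log₂-seq n m * S) * (L * inv L) + ε * (L * S)
      ≡⟨ solve 6 (λ a b c d e f → a :* (b :* c) :* (d :* e) :+ f :* (d :* c)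
             := (a :* b :* e :+ f) :* (d :* c)) refl (ι 2) (log₂-seq n m) S L (inv L) ε ⟩
    (ι 2 * log₂-seq n m * inv L + ε) * (L * S)
      ≤⟨ ℚ.*-monoʳ-≤-nonNeg (L * S) {{LS≥0}} gap′ ⟩
    ι i * (L * S)
      ≡⟨ cong (ι i *_) (/-cancel q m) ⟩
    ι i * ι q ∎
    where
    S = ι (suc m)
    LS≥0 : ℚ.NonNegative (L * S)
    LS≥0 = subst ℚ.NonNegative (sym (/-cancel q m)) (ℚ.nonNegative (0≤ι q))
    gap′ : ι 2 * log₂-seq n m * inv L + ε ≤ ι i
    gap′ = subst₂ (λ x y → x * log₂-seq n m * inv L + ε ≤ y) (sym (ι-def 2)) (sym (ι-def i)) (gap m (ℕ.m≤m⊔n N M))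

------------------------------------------------------------------------
-- Passage to the limit

-- If infinitely many terms of a convergent sequence lie within B of q, then the
-- limit lies within any b > B of q.
⟶-close : ∀ {a : ℕ → ℚ} {x} → a ⟶ x → ∀ q b B → B ℚ.< b →
  (∀ N → ∃[ j ] (N ℕ.≤ j × ∣ a j - q ∣ ≤ B)) → ∣ x -ᴿ fromℚ q ∣ᴿ <ᴿ fromℚ b
⟶-close {a} {x} a⟶x q b B B<b frequently = δ , δ>0 , M , λ m M≤m → begin
  ∣ seq x m - q ∣ + δ
    ≡⟨ cong (λ z → ∣ z ∣ + δ) (solve 3 (λ x a q → x :- q := (a :- q) :- (a :- x)) refl (seq x m) (a j) q) ⟩
  ∣ (a j - q) - (a j - seq x m) ∣ + δ
    ≤⟨ ℚ.+-monoˡ-≤ δ (ℚ.∣p-q∣≤∣p∣+∣q∣ (a j - q) (a j - seq x m)) ⟩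
  ∣ a j - q ∣ + ∣ a j - seq x m ∣ + δ
    ≤⟨ ℚ.+-monoˡ-≤ δ (ℚ.+-mono-≤ ∣aⱼ-q∣≤B (near m M≤m)) ⟩
  B + δ + δ
    ≡⟨ solve 2 (λ b c → c :+ con ½ :* (b :- c) :+ con ½ :* (b :- c) := b) refl b B ⟩
  b ∎
  where
  open ℚ.≤-Reasoning
  open +-*-Solver
  -- Half of the room between B and b goes to the distance from aⱼ to the limit,
  -- the other half is the gap required by the strict inequality of reals.
  δ = ½ * (b - B)
  δ>0 : 0ℚ ℚ.< δ
  δ>0 = ℚ.positive⁻¹ δ {{ℚ.pos*pos⇒pos ½ (b - B) {{ℚ.positive (subst (ℚ._< b - B) (ℚ.+-inverseʳ B) (ℚ.+-monoˡ-< (- B) B<b))}}}}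
  N = proj₁ (a⟶x δ δ>0)
  j = proj₁ (frequently N)
  ∣aⱼ-q∣≤B = proj₂ (proj₂ (frequently N))
  close : ∣ fromℚ (a j) -ᴿ x ∣ᴿ <ᴿ fromℚ δ
  close = proj₂ (a⟶x δ δ>0) j (proj₁ (proj₂ (frequently N)))
  M = proj₁ (proj₂ (proj₂ close))
  near : ∀ m → M ℕ.≤ m → ∣ a j - seq x m ∣ ≤ δ
  near m M≤m = ℚ.≤-trans
    (subst (_≤ ∣ a j - seq x m ∣ + proj₁ close) (ℚ.+-identityʳ ∣ a j - seq x m ∣) (ℚ.+-monoʳ-≤ ∣ a j - seq x m ∣ (ℚ.<⇒≤ (proj₁ (proj₂ close)))))
    (proj₂ (proj₂ (proj₂ close)) m M≤m)

theorem3p4 : ∀ (n k : ℕ) .{{_ : NonZero n}} (1<k : 1 < k) (c : Bool) (S : InitialSet) →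
    let πᵢ = growth {k} {n} S (linearConnective c) in
    (π : BoolFun n → ℝ) → (∀ f → (λ i → πᵢ i f) ⟶ π f) →
    ∀ i → (fromℕ 2 *ᴿ log₂ n) /ᴿ log₂ k [ 0<log₂ 1<k ] <ᴿ fromℕ i →
    ∀ f → IsLinear f → ∣ π f -ᴿ fromℚ (πᵢ i f) ∣ᴿ <ᴿ fromℚ (2^- n)
-- The hypothesis fails for i = 0, since k^0 = 1 ≤ n².
theorem3p4 n k 1<k c S π πᵢ⟶π zero h f lf =
  contradiction (n²<kⁱ n k 1<k zero h) (ℕ.≤⇒≯ (ℕ.*-mono-≤ (ℕ.>-nonZero⁻¹ n) (ℕ.>-nonZero⁻¹ n)))
theorem3p4 n k 1<k c S π πᵢ⟶π (suc i) h f lf =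
  ⟶-close {λ j → growth {k} {n} S (linearConnective c) j f} {π f} (πᵢ⟶π f) (growth {k} {n} S (linearConnective c) (suc i) f) (2^- n)
    (proj₁ close) (proj₁ (proj₂ close)) λ N →
      suc (N ℕ.* 2 ℕ.+ i)
      , ℕ.m≤n⇒m≤1+n (ℕ.≤-trans (ℕ.m≤m*n N 2) (ℕ.m≤m+n (N ℕ.* 2) i))
      , proj₂ (proj₂ close) N f lf
  where
  close = growth-close {n} S 1<k c i (n²<kⁱ n k 1<k (suc i) h)
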